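{- Let $m\ge1$ and let $a_1,\dots,a_m\ge2$ be integers. Then the adjacent cycle chain $C_{a_1}+C_{a_2}+\cdots+C_{a_m}$ is $e$-positive.
   Context: $C_a$ is the cycle graph on $\{1,\dots,a\}$ with edges $(1,2),(2,3),\dots,(a-1,a),(a,1)$ (for $a=2$ this is a single edge). If $G_1,G_2$ are graphs with vertices labeled $1,\dots,k_1$ and $1,\dots,k_2$, then $G_1+G_2$ is the graph on $\{1,\dots,k_1+k_2-1\}$ with edge set $E(G_1)\cup\{(i+k_1-1,j+k_1-1):(i,j)\in E(G_2)\}$, i.e. the last vertex of $G_1$ is identified with the first vertex of $G_2$; this operation is associative. An adjacent cycle chain is a graph of the form $C_{a_1}+\cdots+C_{a_m}$ with $m\ge1$ and all $a_i\ge2$. The chromatic symmetric function of a graph $G$ with $n$ vertices is $X_G(\boldsymbol{x})=\sum_\kappa\prod_{v\in V(G)}x_{\kappa(v)}$, summed over proper colorings $\kappa:V(G)\to\mathbb{N}$, in infinitely many variables $\boldsymbol{x}=(x_i)_{i\in\mathbb{N}}$. $e_k=\sum_{i_1<\cdots<i_k}x_{i_1}\cdots x_{i_k}$ and $e_\lambda=\prod_i e_{\lambda_i}$ for a partition $\lambda$. $X_G$ is uniquely a linear combination $\sum_\lambda c_\lambda e_\lambda$ over partitions $\lambda$ of $n$, and $G$ is $e$-positive if all $c_\lambda\ge0$. -}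

module Defs where

open import Data.Nat using (ℕ; zero; suc; _+_; _∸_; _≤_; _≥_; _≤?_; _≥?_; _≟_; NonZero)
open import Data.Nat.Properties using (+-suc)
open import Data.Integer as ℤ using (ℤ; 0ℤ; 1ℤ)
open import Data.Fin using (Fin; zero; suc; inject₁; fromℕ; cast; _↑ˡ_; _↑ʳ_)
open import Data.Vec using (Vec; []; _∷_; lookup; count; toList)
open import Data.List using
  (List; []; _∷_; [_]; _++_; map; foldr; filter; length; upTo; allFin; concatMap; cartesianProductWith)
open import Data.Nat.ListAction using (sum)
open import Data.List.Properties using (≡-dec)
open import Data.List.Relation.Unary.All using (All; all?)
open import Data.List.Relation.Unary.Linked using (Linked; linked?)
open import Data.Product using (_×_; _,_; ∃-syntax)
open import Data.Bool using (if_then_else_)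
open import Function using (_∘_)
open import Relation.Nullary using (Dec; ¬?; does; _×-dec_)
open import Relation.Binary.PropositionalEquality using (_≡_; _≢_)

words : ∀ {A : Set} → List A → (n : ℕ) → List (Vec A n)
words xs zero    = [ [] ]
words xs (suc n) = cartesianProductWith _∷_ xs (words xs n)

sumℤ : List ℤ → ℤ
sumℤ = foldr ℤ._+_ 0ℤ

------------------------------------------------------------------------
-- Graphs

-- A graph with at least one vertex. The element i of Fin order is the
-- vertex labelled toℕ i + 1. The list of edges is read as a set of unordered
-- pairs: only properness of colourings is ever tested against it, and that
-- depends on neither the orientation nor the multiplicity of an entry.
record Graph : Set where
  field
    last : ℕ

  order : ℕ
  order = suc last

  field
    edges : List (Fin order × Fin order)

open Graph public

-- For a = 2 the two listed pairs are the same unordered edge.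
cycle : (a : ℕ) → 2 ≤ a → Graph
cycle (suc k) _ = record
  { last  = k
  ; edges = map (λ i → inject₁ i , suc i) (allFin k) ++ [ (fromℕ k , zero) ]
  }

infixr 6 _⊕_

-- The graph sum G₁ + G₂. Here k₁ - 1 is last G₁, so the second family
-- of edges is shifted by k₁ - 1 and the order is k₁ + k₂ - 1.
_⊕_ : Graph → Graph → Graph
G₁ ⊕ G₂ = record
  { last  = last G₁ + last G₂
  ; edges = map (λ (u , v) → left u , left v) (edges G₁)
         ++ map (λ (u , v) → right u , right v) (edges G₂)
  }
  where
  left : Fin (order G₁) → Fin (suc (last G₁ + last G₂))
  left u = u ↑ˡ last G₂

  right : Fin (order G₂) → Fin (suc (last G₁ + last G₂))
  right v = cast (+-suc (last G₁) (last G₂)) (last G₁ ↑ʳ v)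

cycleChain : (m : ℕ) .{{_ : NonZero m}} (a : Fin m → ℕ) → (∀ i → 2 ≤ a i) → Graph
cycleChain (suc zero)    a a≥2 = cycle (a zero) (a≥2 zero)
cycleChain (suc (suc m)) a a≥2 =
  cycle (a zero) (a≥2 zero) ⊕ cycleChain (suc m) (a ∘ suc) (a≥2 ∘ suc)

------------------------------------------------------------------------
-- Formal power series in the variables x₀, x₁, x₂, …

-- α₀ ∷ … ∷ αᵣ₋₁ ∷ [] stands for x₀^α₀ ⋯ xᵣ₋₁^αᵣ₋₁. Trailing zeros make no
-- difference to the monomial, nor to the coefficients of the series below.
Monomial : Set
Monomial = List ℕ

-- A series is given by its coefficients.
Series : Set
Series = Monomial → ℤ

infix 4 _≈_
_≈_ : Series → Series → Set
f ≈ g = ∀ α → f α ≡ g α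

𝟙 : Series
𝟙 α = if does (all? (_≟ 0) α) then 1ℤ else 0ℤ

-- All pairs (β , γ) of monomials with β γ = α.
factorizations : Monomial → List (Monomial × Monomial)
factorizations []      = [ ([] , []) ]
factorizations (n ∷ α) =
  cartesianProductWith (λ j (β , γ) → (j ∷ β , n ∸ j ∷ γ)) (upTo (suc n)) (factorizations α)

infixl 7 _·_
_·_ : Series → Series → Series
(f · g) α = sumℤ (map (λ (β , γ) → f β ℤ.* g γ) (factorizations α))

-- The monomials x_{i₁} ⋯ x_{iₖ} with i₁ < ⋯ < iₖ are the squarefree ones of
-- degree k.
e : ℕ → Series
e k α = if does (all? (_≤? 1) α ×-dec (sum α ≟ k)) then 1ℤ else 0ℤ

eₗ : List ℕ → Series
eₗ parts = foldr _·_ 𝟙 (map e parts)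

------------------------------------------------------------------------
-- Partitions

IsPartition : ℕ → List ℕ → Set
IsPartition n parts = Linked _≥_ parts × All (1 ≤_) parts × sum parts ≡ n

isPartition? : ∀ n parts → Dec (IsPartition n parts)
isPartition? n parts = linked? _≥?_ parts ×-dec all? (1 ≤?_) parts ×-dec (sum parts ≟ n)

-- Each partition of n occurs exactly once: it has at most n parts, each of
-- them at most n.
partitions : ℕ → List (List ℕ)
partitions n = filter (isPartition? n)
  (concatMap (λ l → map toList (words (upTo (suc n)) l)) (upTo (suc n)))

------------------------------------------------------------------------
-- The chromatic symmetric function

Colouring : Graph → Set
Colouring G = Vec ℕ (order G)

Proper : (G : Graph) → Colouring G → Set
Proper G κ = All (λ (u , v) → lookup κ u ≢ lookup κ v) (edges G)

proper? : ∀ G κ → Dec (Proper G κ)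
proper? G κ = all? (λ (u , v) → ¬? (lookup κ u ≟ lookup κ v)) (edges G)

-- The monomial ∏ᵥ x_{κ(v)}, written with r exponents; this is correct when
-- every colour used by κ is less than r.
monomial : ∀ {n} → ℕ → Vec ℕ n → Monomial
monomial r κ = map (λ i → count (_≟ i) κ) (upTo r)

-- The coefficient of α in X_G is the number of proper colourings
-- κ : V(G) → ℕ whose monomial is α; such a κ only uses colours less than
-- length α.
X : Graph → Series
X G α = ℤ.+ length (filter
  (λ κ → proper? G κ ×-dec ≡-dec _≟_ (monomial (length α) κ) α)
  (words (upTo (length α)) (order G)))

eCombination : ℕ → (List ℕ → ℤ) → Series
eCombination n c α = sumℤ (map (λ p → c p ℤ.* eₗ p α) (partitions n))

-- Only the values of c at partitions of n matter. Since the e_λ are a basis,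
-- these are the coefficients of the unique e-expansion of X G.
EPositive : Graph → Set
EPositive G = ∃[ c ] (X G ≈ eCombination (order G) c
                      × All (λ p → 0ℤ ℤ.≤ c p) (partitions (order G)))

{-# OPTIONS --safe #-}

-- For a chain G let F(j) be the generating function of the proper colourings
-- in which the first vertex has colour j, and let u k j be the sum of the
-- monomials of e_k divisible by x_j. We show by induction on the number of
-- cycles that F is a combination of the u k with e-positive coefficients; then
-- so is its sum over j, because ∑ⱼ u k j = k e_k.
--
-- Attaching a cycle on n + 2 vertices replaces F by
--   F′(j) = x_j ∑_{c ≠ j} F(c) ∑_{a+b=n} w_a g_b(c,j),
-- where ∑ w_n tⁿ = 1 / (1 − ∑ (k−1) e_k tᵏ) is e-positive and g_b(c,j) is e_b in
-- the variables other than x_c and x_j. So it is enough to expand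
-- V k n = x_j ∑_{c ≠ j} u k c · g_{n−1}(c,j), and with N = k + n, p = min(k,n),
--   V k n = ∑_{l=1}^{p} (k−l) e_{N−l} u l + ∑_{i<p} (n−i) e_i u (N−i),
-- all of whose coefficients are nonnegative.
module Submission where

open import Algebra.Bundles using (CommutativeRing)
open import Data.Bool using (true; false; if_then_else_)
open import Data.Bool.Properties using (∧-zeroʳ)
open import Data.Empty using (⊥-elim)
open import Data.Fin using (Fin; zero; suc; toℕ; inject₁; cast; _↑ˡ_; _↑ʳ_)
import Data.Fin.Properties as Finₚ
open import Data.Integer as ℤ using (ℤ; 0ℤ; 1ℤ; +_; +≤+)
import Data.Integer.Properties as ℤₚ
open import Data.List using
  (List; []; _∷_; [_]; map; _++_; length; filter; upTo; applyUpTo; allFin; concatMap; cartesianProductWith)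
open import Data.List.Membership.Propositional using (_∈_; lose)
open import Data.List.Membership.Propositional.Properties
  using (∈-map⁺; ∈-map⁻; ∈-filter⁺; ∈-concatMap⁺; ∈-cartesianProductWith⁺; ∈-upTo⁺)
open import Data.List.Properties using (≡-dec; ∷-injective; map-++; map-∘; map-applyUpTo; length-applyUpTo)
open import Data.List.Relation.Binary.Permutation.Propositional
  using (_↭_; prep; swap; ↭-sym) renaming (refl to ↭-refl; trans to ↭-trans)
open import Data.List.Relation.Binary.Permutation.Propositional.Properties using (All-resp-↭)
open import Data.List.Relation.Unary.All as All using (All; []; _∷_; all?)
import Data.List.Relation.Unary.All.Properties as Allₚ
open import Data.List.Relation.Unary.AllPairs using ([]; _∷_)
import Data.List.Relation.Unary.AllPairs.Properties as AllPairsₚ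
open import Data.List.Relation.Unary.Any using (here; there)
open import Data.List.Relation.Unary.Unique.Propositional using (Unique)
import Data.List.Relation.Unary.Unique.Propositional.Properties as Uniqueₚ
import Data.List.Sort as Sort
open import Data.Nat as ℕ using (ℕ; zero; suc; _≤_; _<_; _∸_; _⊓_; z≤n; s≤s; NonZero)
open import Data.Nat.ListAction using (sum)
open import Data.Nat.ListAction.Properties using (sum-++; sum-↭)
import Data.Nat.Properties as ℕₚ
open import Data.Product using (_×_; _,_; ∃-syntax; proj₁; proj₂)
open import Data.Sum using (inj₁; inj₂)
open import Data.Unit using (⊤; tt)
open import Data.Vec using (Vec; []; _∷_; toList; fromList; lookup; count)
import Data.Vec.Properties as Vecₚ
open import Function using (_∘_; id; _⇔_; mk⇔; Equivalence)
open import Level using (0ℓ)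
import Relation.Binary.Construct.Flip.EqAndOrd as Flip
open import Relation.Binary.PropositionalEquality as ≡ using (_≡_; _≢_)
open import Relation.Nullary using (Dec; ¬_; yes; no; does; ¬?; _×-dec_)
open import Relation.Nullary.Decidable using (does-⇔)

-- Finite sums and convolutions in a commutative ring

-- With E(t) = ∑ e_k tᵏ, the weights are W(t) = ∑ w_n tⁿ = 1 / (E - t E′), and ∑ w_a g_b(c,j) is a
-- coefficient of W E / ((1 + x_c t)(1 + x_j t)). It arises from a duality: W E / (1 + x_c t) counts
-- coloured paths whose first vertex avoids the colour c, and steps can be moved from the unknown
-- walk to this explicit series.
--
-- The obstacle is sign. On an antidiagonal k + n = N, neighbouring values of V differ by a
-- multiple, of either sign, of some e u and by a product u u, which is not linear in u. That
-- product is a difference of two sums of terms e u: it raises all coefficients of one half of the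
-- expansion by 1 and lowers those of the other. Starting at the end of the antidiagonal nearer to
-- (k,n), where V vanishes, keeps every coefficient nonnegative.
--
-- Euler's relation ∑ⱼ u k j = k e_k is applied as a finite sum over r variables, yet the expansion
-- must be chosen before r. Hence the rings for different r share carrier and operations and differ
-- only in their equality.

conv : {A : Set} → (A → A → A) → ℕ → (ℕ → ℕ → A) → A
conv _+_ zero    G = G 0 0
conv _+_ (suc n) G = G 0 (suc n) + conv _+_ n (λ i j → G (suc i) j)

-- Bare operations instead of a ring, here and in `conv`: a sum in `seriesRing r` is then the same
-- term for every `r`.
∑ : {A : Set} → (A → A → A) → A → ℕ → (ℕ → A) → A
∑ _+_ 0# zero    f = 0#
∑ _+_ 0# (suc n) f = ∑ _+_ 0# n f + f n

module RingSums (R : CommutativeRing 0ℓ 0ℓ) where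
  open CommutativeRing R
  open import Algebra.Properties.CommutativeSemigroup +-commutativeSemigroup public
    using (interchange)
  open import Relation.Binary.Reasoning.Setoid setoid

  conv-cong : ∀ n {G H : ℕ → ℕ → Carrier} →
    (∀ i j → i ℕ.+ j ≡ n → G i j ≈ H i j) → conv _+_ n G ≈ conv _+_ n H
  conv-cong zero    eq = eq 0 0 ≡.refl
  conv-cong (suc n) eq =
    +-cong (eq 0 (suc n) ≡.refl) (conv-cong n λ i j i+j≡n → eq (suc i) j (≡.cong suc i+j≡n))

  conv-+ : ∀ n (G H : ℕ → ℕ → Carrier) →
    conv _+_ n (λ i j → G i j + H i j) ≈ conv _+_ n G + conv _+_ n H
  conv-+ zero    G H = refl
  conv-+ (suc n) G H =
    trans (+-congˡ (conv-+ n (λ i → G (suc i)) (λ i → H (suc i)))) (interchange _ _ _ _)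

  conv-*ˡ : ∀ n a (G : ℕ → ℕ → Carrier) →
    conv _+_ n (λ i j → a * G i j) ≈ a * conv _+_ n G
  conv-*ˡ zero    a G = refl
  conv-*ˡ (suc n) a G =
    trans (+-congˡ (conv-*ˡ n a (λ i → G (suc i)))) (sym (distribˡ a _ _))

  conv-last : ∀ n (G : ℕ → ℕ → Carrier) →
    conv _+_ (suc n) G ≈ conv _+_ n (λ i j → G i (suc j)) + G (suc n) 0
  conv-last zero    G = refl
  conv-last (suc n) G = trans (+-congˡ (conv-last n (λ i → G (suc i)))) (sym (+-assoc _ _ _))

  conv-flip : ∀ n (G : ℕ → ℕ → Carrier) → conv _+_ n G ≈ conv _+_ n (λ i j → G j i)
  conv-flip zero    G = refl
  conv-flip (suc n) G = begin
    G 0 (suc n) + conv _+_ n (λ i j → G (suc i) j) ≈⟨ +-congˡ (conv-flip n λ i j → G (suc i) j) ⟩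
    G 0 (suc n) + conv _+_ n (λ i j → G (suc j) i) ≈⟨ +-comm _ _ ⟩
    conv _+_ n (λ i j → G (suc j) i) + G 0 (suc n) ≈⟨ conv-last n (λ i j → G j i) ⟨
    conv _+_ (suc n) (λ i j → G j i)               ∎

  conv-assoc : ∀ n (F : ℕ → ℕ → ℕ → Carrier) →
    conv _+_ n (λ m k → conv _+_ m (λ i j → F i j k)) ≈
    conv _+_ n (λ i m → conv _+_ m (λ j k → F i j k))
  conv-assoc zero    F = refl
  conv-assoc (suc n) F = begin
    F 0 0 (suc n) + conv _+_ n (λ m k → F 0 (suc m) k + conv _+_ m (λ i j → F (suc i) j k))
      ≈⟨ +-congˡ (conv-+ n _ _) ⟩
    F 0 0 (suc n) + (conv _+_ n (λ m k → F 0 (suc m) k)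
      + conv _+_ n (λ m k → conv _+_ m (λ i j → F (suc i) j k)))
      ≈⟨ +-congˡ (+-congˡ (conv-assoc n (λ i → F (suc i)))) ⟩
    F 0 0 (suc n) + (conv _+_ n (λ m k → F 0 (suc m) k)
      + conv _+_ n (λ i m → conv _+_ m (λ j k → F (suc i) j k)))
      ≈⟨ +-assoc _ _ _ ⟨
    conv _+_ (suc n) (λ i m → conv _+_ m (λ j k → F i j k)) ∎

  ∑-cong : ∀ n {f g : ℕ → Carrier} → (∀ i → i < n → f i ≈ g i) → ∑ _+_ 0# n f ≈ ∑ _+_ 0# n g
  ∑-cong zero    eq = refl
  ∑-cong (suc n) eq = +-cong (∑-cong n λ i i<n → eq i (ℕₚ.m<n⇒m<1+n i<n)) (eq n ℕₚ.≤-refl)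

  ∑-+ : ∀ n (f g : ℕ → Carrier) →
    ∑ _+_ 0# n (λ i → f i + g i) ≈ ∑ _+_ 0# n f + ∑ _+_ 0# n g
  ∑-+ zero    f g = sym (+-identityˡ 0#)
  ∑-+ (suc n) f g = trans (+-congʳ (∑-+ n f g)) (interchange _ _ _ _)

  ∑-*ˡ : ∀ n a (f : ℕ → Carrier) → ∑ _+_ 0# n (λ i → a * f i) ≈ a * ∑ _+_ 0# n f
  ∑-*ˡ zero    a f = sym (zeroʳ a)
  ∑-*ˡ (suc n) a f = trans (+-congʳ (∑-*ˡ n a f)) (sym (distribˡ a _ _))

  ∑-*ʳ : ∀ n (f : ℕ → Carrier) a → ∑ _+_ 0# n (λ i → f i * a) ≈ ∑ _+_ 0# n f * a
  ∑-*ʳ n f a = trans (∑-cong n λ i _ → *-comm (f i) a) (trans (∑-*ˡ n a f) (*-comm a _))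

  ∑-zero : ∀ n {f : ℕ → Carrier} → (∀ i → i < n → f i ≈ 0#) → ∑ _+_ 0# n f ≈ 0#
  ∑-zero zero    eq = refl
  ∑-zero (suc n) eq = trans
    (+-cong (∑-zero n λ i i<n → eq i (ℕₚ.m<n⇒m<1+n i<n)) (eq n ℕₚ.≤-refl)) (+-identityˡ 0#)

  ∑-head : ∀ n (f : ℕ → Carrier) → ∑ _+_ 0# (suc n) f ≈ f 0 + ∑ _+_ 0# n (λ i → f (suc i))
  ∑-head zero    f = +-comm _ _
  ∑-head (suc n) f = trans (+-congʳ (∑-head n f)) (+-assoc _ _ _)

  ∑-conv : ∀ r n (G : ℕ → ℕ → ℕ → Carrier) →
    ∑ _+_ 0# r (λ c → conv _+_ n (G c)) ≈ conv _+_ n (λ i j → ∑ _+_ 0# r (λ c → G c i j))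
  ∑-conv r zero    G = refl
  ∑-conv r (suc n) G = trans (∑-+ r _ _) (+-congˡ (∑-conv r n (λ c i → G c (suc i))))

  unless : ∀ {P : Set} → Dec P → Carrier → Carrier
  unless P? a = if does P? then 0# else a

  unless-yes : ∀ {P : Set} (P? : Dec P) {a} → P → unless P? a ≈ 0#
  unless-yes (yes _) p = refl
  unless-yes (no ¬p) p = ⊥-elim (¬p p)

  unless-no : ∀ {P : Set} (P? : Dec P) {a} → ¬ P → unless P? a ≈ a
  unless-no (yes p) ¬p = ⊥-elim (¬p p)
  unless-no (no _)  ¬p = refl

  unless-cong : ∀ {P : Set} (P? : Dec P) {a b} → (¬ P → a ≈ b) →
    unless P? a ≈ unless P? b
  unless-cong (yes _)  eq = refl
  unless-cong (no ¬p) eq = eq ¬p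

  unless-+ : ∀ {P : Set} (P? : Dec P) a b → unless P? (a + b) ≈ unless P? a + unless P? b
  unless-+ (yes _) a b = sym (+-identityˡ 0#)
  unless-+ (no _)  a b = refl

  unless-*ˡ : ∀ {P : Set} (P? : Dec P) a b → unless P? (a * b) ≈ a * unless P? b
  unless-*ˡ (yes _) a b = sym (zeroʳ a)
  unless-*ˡ (no _)  a b = refl

  ∑≠ : ℕ → ℕ → (ℕ → Carrier) → Carrier
  ∑≠ r j f = ∑ _+_ 0# r (λ i → unless (i ℕ.≟ j) (f i))

  ∑≠-cong : ∀ r j {f g : ℕ → Carrier} → (∀ i → i < r → i ≢ j → f i ≈ g i) → ∑≠ r j f ≈ ∑≠ r j g
  ∑≠-cong r j eq = ∑-cong r λ i i<r → unless-cong (i ℕ.≟ j) (eq i i<r)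

  ∑≠-+ : ∀ r j (f g : ℕ → Carrier) → ∑≠ r j (λ i → f i + g i) ≈ ∑≠ r j f + ∑≠ r j g
  ∑≠-+ r j f g = trans (∑-cong r λ i _ → unless-+ (i ℕ.≟ j) (f i) (g i)) (∑-+ r _ _)

  ∑≠-*ˡ : ∀ r j a (f : ℕ → Carrier) → ∑≠ r j (λ i → a * f i) ≈ a * ∑≠ r j f
  ∑≠-*ˡ r j a f = trans (∑-cong r λ i _ → unless-*ˡ (i ℕ.≟ j) a (f i)) (∑-*ˡ r a _)

  ∑≠-out : ∀ r j (f : ℕ → Carrier) → r ≤ j → ∑≠ r j f ≈ ∑ _+_ 0# r f
  ∑≠-out r j f r≤j = ∑-cong r λ i i<r →
    unless-no (i ℕ.≟ j) (ℕₚ.<⇒≢ (ℕₚ.<-≤-trans i<r r≤j))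

  ∑≠-split : ∀ r j (f : ℕ → Carrier) → j < r → ∑≠ r j f + f j ≈ ∑ _+_ 0# r f
  ∑≠-split (suc r) j f j<1+r with r ℕ.≟ j
  ... | yes ≡.refl = +-congʳ (trans
    (+-cong (∑≠-out r r f ℕₚ.≤-refl) (unless-yes (r ℕ.≟ r) ≡.refl)) (+-identityʳ _))
  ... | no r≢j = begin
    ∑≠ r j f + unless (r ℕ.≟ j) (f r) + f j ≈⟨ +-congʳ (+-congˡ (unless-no (r ℕ.≟ j) r≢j)) ⟩
    ∑≠ r j f + f r + f j   ≈⟨ +-assoc _ _ _ ⟩
    ∑≠ r j f + (f r + f j) ≈⟨ +-congˡ (+-comm _ _) ⟩
    ∑≠ r j f + (f j + f r) ≈⟨ +-assoc _ _ _ ⟨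
    ∑≠ r j f + f j + f r   ≈⟨ +-congʳ (∑≠-split r j f (ℕₚ.≤∧≢⇒< (ℕₚ.≤-pred j<1+r) λ j≡r → r≢j (≡.sym j≡r))) ⟩
    ∑ _+_ 0# r f + f r     ∎

  ∑≠-conv : ∀ r j n (G : ℕ → ℕ → ℕ → Carrier) →
    ∑≠ r j (λ c → conv _+_ n (G c)) ≈ conv _+_ n (λ a b → ∑≠ r j (λ c → G c a b))
  ∑≠-conv r j zero    G = refl
  ∑≠-conv r j (suc n) G = trans (∑≠-+ r j _ _) (+-congˡ (∑≠-conv r j n (λ c i → G c (suc i))))

-- Attaching a cycle

module _ (R : CommutativeRing 0ℓ 0ℓ) where
  open CommutativeRing R

  -- Only these relations between e, h and u enter the computation. `ι` is the image of ℕ in the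
  -- ring, and `w-suc` is W (E - t E′) = 1 read at tⁿ⁺¹: `ι b * e (suc b)` is (k - 1) e_k with k = b
  -- + 1.
  module Attach
    (ι : ℕ → Carrier) (ι-zero : ι 0 ≈ 0#) (ι-suc : ∀ n → ι (suc n) ≈ 1# + ι n)
    (r : ℕ) (x : ℕ → Carrier) (e : ℕ → Carrier) (h u : ℕ → ℕ → Carrier)
    (e-split : ∀ k j → h k j + u k j ≈ e k)
    (h-zero : ∀ j → h 0 j ≈ 1#)
    (u-zero : ∀ j → u 0 j ≈ 0#)
    (u-suc : ∀ k j → u (suc k) j ≈ x j * h k j)
    (euler : ∀ k → ∑ _+_ 0# r (u k) ≈ ι k * e k)
    (w : ℕ → Carrier) (w-zero : w 0 ≈ 1#)
    (w-suc : ∀ n → w (suc n) ≈ conv _+_ n (λ a b → w a * (ι b * e (suc b))))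
    where

    open RingSums R
    open import Algebra.Properties.AbelianGroup +-abelianGroup using () renaming (∙-cancelʳ to +-cancelʳ)
    open import Algebra.Solver.Ring.NaturalCoefficients.Default commutativeSemiring
      using (solve; _:+_; _:*_; _:=_)
    open import Relation.Binary.Reasoning.Setoid setoid

    ι-+ : ∀ m n → ι (m ℕ.+ n) ≈ ι m + ι n
    ι-+ zero n = sym (trans (+-congʳ ι-zero) (+-identityˡ _))
    ι-+ (suc m) n = begin
      ι (suc (m ℕ.+ n)) ≈⟨ ι-suc _ ⟩
      1# + ι (m ℕ.+ n)  ≈⟨ +-congˡ (ι-+ m n) ⟩
      1# + (ι m + ι n)  ≈⟨ +-assoc _ _ _ ⟨
      1# + ι m + ι n    ≈⟨ +-congʳ (ι-suc m) ⟨
      ι (suc m) + ι n   ∎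

    ι-suc-* : ∀ n a → ι (suc n) * a ≈ ι n * a + a
    ι-suc-* n a = begin
      ι (suc n) * a    ≈⟨ *-congʳ (ι-suc n) ⟩
      (1# + ι n) * a   ≈⟨ distribʳ a 1# (ι n) ⟩
      1# * a + ι n * a ≈⟨ +-comm _ _ ⟩
      ι n * a + 1# * a ≈⟨ +-congˡ (*-identityˡ a) ⟩
      ι n * a + a      ∎

    h-suc : ∀ k j → h (suc k) j + x j * h k j ≈ e (suc k)
    h-suc k j = trans (+-congˡ (sym (u-suc k j))) (e-split (suc k) j)

    e-zero : e 0 ≈ 1#
    e-zero = begin
      e 0           ≈⟨ e-split 0 0 ⟨
      h 0 0 + u 0 0 ≈⟨ +-cong (h-zero 0) (u-zero 0) ⟩
      1# + 0#       ≈⟨ +-identityʳ 1# ⟩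
      1#            ∎

    u-one : ∀ j → u 1 j ≈ x j
    u-one j = trans (u-suc 0 j) (trans (*-congˡ (h-zero j)) (*-identityʳ (x j)))

    -- In generating functions: (1 + y t) P = Q implies (1 + y t) W P = W Q, compared at tⁿ⁺¹.
    w-conv-step : ∀ y {p q : ℕ → Carrier} → (∀ b → p (suc b) + y * p b ≈ q (suc b)) → p 0 ≈ q 0 →
      ∀ n → conv _+_ (suc n) (λ a b → w a * p b) + y * conv _+_ n (λ a b → w a * p b)
          ≈ conv _+_ (suc n) (λ a b → w a * q b)
    w-conv-step y {p} {q} step p₀≈q₀ n = begin
      conv _+_ (suc n) (λ a b → w a * p b) + y * conv _+_ n (λ a b → w a * p b)
        ≈⟨ +-cong (conv-last n (λ a b → w a * p b)) (sym (conv-*ˡ n y _)) ⟩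
      conv _+_ n (λ a b → w a * p (suc b)) + w (suc n) * p 0 + conv _+_ n (λ a b → y * (w a * p b))
        ≈⟨ solve 3 (λ a b c → a :+ b :+ c := a :+ c :+ b) refl _ _ _ ⟩
      conv _+_ n (λ a b → w a * p (suc b)) + conv _+_ n (λ a b → y * (w a * p b)) + w (suc n) * p 0
        ≈⟨ +-congʳ (conv-+ n _ _) ⟨
      conv _+_ n (λ a b → w a * p (suc b) + y * (w a * p b)) + w (suc n) * p 0
        ≈⟨ +-cong (conv-cong n λ a b _ → trans
             (solve 4 (λ y w p p′ → w :* p′ :+ y :* (w :* p) := w :* (p′ :+ y :* p)) refl y (w a) (p b) (p (suc b)))
             (*-congˡ (step b))) (*-congˡ p₀≈q₀) ⟩
      conv _+_ n (λ a b → w a * q (suc b)) + w (suc n) * q 0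
        ≈⟨ conv-last n (λ a b → w a * q b) ⟨
      conv _+_ (suc n) (λ a b → w a * q b) ∎

    -- The coefficient of tⁿ in W E / (1 + x_c t). By `H-suc` and `∑xH≈T`, H (n+1) c is the sum of
    -- x_d H n d over d ≠ c, so H n c counts coloured paths on n vertices whose first colour is not
    -- c.
    H : ℕ → ℕ → Carrier
    H n c = conv _+_ n (λ a b → w a * h b c)

    T : ℕ → Carrier
    T n = conv _+_ n (λ a b → w a * (ι (suc b) * e (suc b)))

    -- W (E - t E′) = 1 gives W E = 1 + t W E′, and `T` is the coefficient in W E′. This is the
    -- known expansion of the chromatic symmetric function of a path on n + 1 vertices.
    w-e : ∀ n → conv _+_ (suc n) (λ a b → w a * e b) ≈ T n
    w-e n = begin
      conv _+_ (suc n) (λ a b → w a * e b)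
        ≈⟨ conv-last n (λ a b → w a * e b) ⟩
      conv _+_ n (λ a b → w a * e (suc b)) + w (suc n) * e 0
        ≈⟨ +-congˡ (trans (*-congˡ e-zero) (trans (*-identityʳ _) (w-suc n))) ⟩
      conv _+_ n (λ a b → w a * e (suc b)) + conv _+_ n (λ a b → w a * (ι b * e (suc b)))
        ≈⟨ conv-+ n _ _ ⟨
      conv _+_ n (λ a b → w a * e (suc b) + w a * (ι b * e (suc b)))
        ≈⟨ conv-cong n (λ a b _ → trans
             (solve 3 (λ w e i → w :* e :+ w :* (i :* e) := w :* (i :* e :+ e)) refl (w a) (e (suc b)) (ι b))
             (*-congˡ (sym (ι-suc-* b _)))) ⟩
      T n ∎

    H-suc : ∀ n c → H (suc n) c + x c * H n c ≈ T n
    H-suc n c = trans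
      (w-conv-step (x c) (λ b → h-suc b c) (trans (h-zero c) (sym e-zero)) n) (w-e n)

    -- Since x_c h_b(c) = u_{b+1}(c), Euler's relation evaluates the sum over c in each term of the
    -- convolution.
    ∑xH≈T : ∀ n → ∑ _+_ 0# r (λ c → x c * H n c) ≈ T n
    ∑xH≈T n = begin
      ∑ _+_ 0# r (λ c → x c * H n c)
        ≈⟨ ∑-cong r (λ c _ → conv-*ˡ n (x c) _) ⟨
      ∑ _+_ 0# r (λ c → conv _+_ n (λ a b → x c * (w a * h b c)))
        ≈⟨ ∑-conv r n _ ⟩
      conv _+_ n (λ a b → ∑ _+_ 0# r (λ c → x c * (w a * h b c)))
        ≈⟨ conv-cong n (λ a b _ → begin
             ∑ _+_ 0# r (λ c → x c * (w a * h b c))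
               ≈⟨ ∑-cong r (λ c _ → trans
                    (solve 3 (λ x w h → x :* (w :* h) := w :* (x :* h)) refl (x c) (w a) (h b c))
                    (*-congˡ (sym (u-suc b c)))) ⟩
             ∑ _+_ 0# r (λ c → w a * u (suc b) c)
               ≈⟨ ∑-*ˡ r (w a) _ ⟩
             w a * ∑ _+_ 0# r (u (suc b))
               ≈⟨ *-congˡ (euler (suc b)) ⟩
             w a * (ι (suc b) * e (suc b)) ∎) ⟩
      T n ∎

    H-zero : ∀ c → H 0 c ≈ 1#
    H-zero c = trans (*-cong w-zero (h-zero c)) (*-identityʳ 1#)

    -- g b c j is e_b in the variables other than x c and x j if c ≢ j; the recursion
    -- also gives it a value for c ≡ j, so that sums over c need no side condition.
    g : ℕ → ℕ → ℕ → Carrier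
    g zero    c j = 1#
    g (suc k) c j = h (suc k) c - x j * g k c j

    g-right : ∀ k c j → g (suc k) c j + x j * g k c j ≈ h (suc k) c
    g-right k c j = trans (+-assoc _ _ _) (trans (+-congˡ (-‿inverseˡ _)) (+-identityʳ _))

    -- The definition of `g` divides by 1 + x_j t; here c and j change roles, E / ((1 + x_c t)(1 +
    -- x_j t)) being symmetric in them. Both sides are compared after adding the x_j part, and `lem`
    -- at k + 1 uses `g-left` at k.
    g-left : ∀ k c j → g (suc k) c j + x c * g k c j ≈ h (suc k) j
    g-left k c j = +-cancelʳ (x j * h k j) _ _ (begin
      g (suc k) c j + x c * g k c j + x j * h k j ≈⟨ lem k ⟩
      h (suc k) c + x c * h k c                   ≈⟨ h-suc k c ⟩
      e (suc k)                                   ≈⟨ h-suc k j ⟨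
      h (suc k) j + x j * h k j                   ∎)
      where
      lem : ∀ k → g (suc k) c j + x c * g k c j + x j * h k j ≈ h (suc k) c + x c * h k c
      lem zero = begin
        g 1 c j + x c * 1# + x j * h 0 j
          ≈⟨ +-cong (+-congˡ (*-congˡ (sym (h-zero c)))) (*-congˡ (h-zero j)) ⟩
        g 1 c j + x c * h 0 c + x j * 1#
          ≈⟨ solve 3 (λ a b c → a :+ b :+ c := a :+ c :+ b) refl _ _ _ ⟩
        g 1 c j + x j * 1# + x c * h 0 c
          ≈⟨ +-congʳ (g-right 0 c j) ⟩
        h 1 c + x c * h 0 c ∎
      lem (suc k) = begin
        g (2 ℕ.+ k) c j + x c * g (suc k) c j + x j * h (suc k) j
          ≈⟨ +-congˡ (*-congˡ (g-left k c j)) ⟨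
        g (2 ℕ.+ k) c j + x c * g (suc k) c j + x j * (g (suc k) c j + x c * g k c j)
          ≈⟨ solve 5 (λ a b d x y → a :+ x :* b :+ y :* (b :+ x :* d)
                                := a :+ y :* b :+ x :* (b :+ y :* d)) refl
               (g (2 ℕ.+ k) c j) (g (suc k) c j) (g k c j) (x c) (x j) ⟩
        g (2 ℕ.+ k) c j + x j * g (suc k) c j + x c * (g (suc k) c j + x j * g k c j)
          ≈⟨ +-cong (g-right (suc k) c j) (*-congˡ (g-right k c j)) ⟩
        h (2 ℕ.+ k) c + x c * h (suc k) c ∎

    Γ : ℕ → ℕ → ℕ → Carrier
    Γ n c j = conv _+_ n (λ a b → w a * g b c j)

    Γ-suc : ∀ n c j → Γ (suc n) c j + x j * Γ n c j ≈ H (suc n) c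
    Γ-suc n c j = w-conv-step (x j) (λ b → g-right b c j) (sym (h-zero c)) n

    module Walk (φ : ℕ → Carrier) where

      -- Walks of n steps from colour c, each step changing the colour; φ is the weight of the last
      -- vertex together with everything attached there.
      Q : ℕ → ℕ → Carrier
      Q zero    c = φ c
      Q (suc n) c = x c * ∑≠ r c (Q n)

      Q-suc : ∀ n c → c < r → Q (suc n) c + x c * Q n c ≈ x c * ∑ _+_ 0# r (Q n)
      Q-suc n c c<r = trans (sym (distribˡ _ _ _)) (*-congˡ (∑≠-split r c (Q n) c<r))

      -- H satisfies the transpose of the recursion for Q.
      QH-shift : ∀ m n →
        ∑ _+_ 0# r (λ c → Q (suc m) c * H n c) ≈ ∑ _+_ 0# r (λ c → Q m c * H (suc n) c)
      QH-shift m n = +-cancelʳ (∑ _+_ 0# r (λ c → Q m c * (x c * H n c))) _ _ (begin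
        ∑ _+_ 0# r (λ c → Q (suc m) c * H n c) + ∑ _+_ 0# r (λ c → Q m c * (x c * H n c))
          ≈⟨ ∑-+ r _ _ ⟨
        ∑ _+_ 0# r (λ c → Q (suc m) c * H n c + Q m c * (x c * H n c))
          ≈⟨ ∑-cong r (λ c c<r → trans
               (solve 4 (λ p q x h → p :* h :+ q :* (x :* h) := (p :+ x :* q) :* h) refl
                 (Q (suc m) c) (Q m c) (x c) (H n c))
               (trans (*-congʳ (Q-suc m c c<r))
               (solve 3 (λ x s h → x :* s :* h := s :* (x :* h)) refl (x c) _ (H n c)))) ⟩
        ∑ _+_ 0# r (λ c → ∑ _+_ 0# r (Q m) * (x c * H n c))
          ≈⟨ ∑-*ˡ r _ _ ⟩
        ∑ _+_ 0# r (Q m) * ∑ _+_ 0# r (λ c → x c * H n c)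
          ≈⟨ *-congˡ (∑xH≈T n) ⟩
        ∑ _+_ 0# r (Q m) * T n
          ≈⟨ ∑-*ʳ r (Q m) (T n) ⟨
        ∑ _+_ 0# r (λ c → Q m c * T n)
          ≈⟨ ∑-cong r (λ c _ → trans (*-congˡ (sym (H-suc n c))) (distribˡ _ _ _)) ⟩
        ∑ _+_ 0# r (λ c → Q m c * H (suc n) c + Q m c * (x c * H n c))
          ≈⟨ ∑-+ r _ _ ⟩
        ∑ _+_ 0# r (λ c → Q m c * H (suc n) c) + ∑ _+_ 0# r (λ c → Q m c * (x c * H n c)) ∎)

      QH-invariant : ∀ m n N → m ℕ.+ n ≡ N →
        ∑ _+_ 0# r (λ c → Q m c * H n c) ≈ ∑ _+_ 0# r (λ c → φ c * H N c)
      QH-invariant zero    n .n ≡.refl = refl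
      QH-invariant (suc m) n N  eq = trans (QH-shift m n)
        (QH-invariant m (suc n) N (≡.trans (ℕₚ.+-suc m n) eq))

      -- All n steps are moved from Q to H, starting from H 0 = 1; what remains is explicit and
      -- linear in φ.
      ∑Q : ∀ n → ∑ _+_ 0# r (Q n) ≈ ∑ _+_ 0# r (λ c → φ c * H n c)
      ∑Q n = trans
        (∑-cong r λ c _ → sym (trans (*-congˡ (H-zero c)) (*-identityʳ _)))
        (QH-invariant n 0 n (ℕₚ.+-identityʳ n))

      -- `Q-suc` and `∑Q` express (1 + x_j t) times the series of Q at j through H, and removing
      -- that factor turns H into Γ. The condition φ j = 0 (first and last colour differ) makes the
      -- recursion start correctly.
      Q-closed : ∀ j → j < r → φ j ≈ 0# → ∀ n →
        Q (suc n) j ≈ x j * ∑ _+_ 0# r (λ c → φ c * Γ n c j)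
      Q-closed j j<r φj≈0 zero = begin
        Q 1 j             ≈⟨ +-identityʳ _ ⟨
        Q 1 j + 0#        ≈⟨ +-congˡ (trans (*-congˡ φj≈0) (zeroʳ _)) ⟨
        Q 1 j + x j * φ j ≈⟨ Q-suc 0 j j<r ⟩
        x j * ∑ _+_ 0# r φ
          ≈⟨ *-congˡ (∑-cong r λ c _ → trans
               (*-congˡ (trans (*-congʳ w-zero) (*-identityˡ 1#))) (*-identityʳ _)) ⟨
        x j * ∑ _+_ 0# r (λ c → φ c * Γ 0 c j) ∎
      Q-closed j j<r φj≈0 (suc n) = +-cancelʳ (x j * Q (suc n) j) _ _ (begin
        Q (2 ℕ.+ n) j + x j * Q (suc n) j
          ≈⟨ Q-suc (suc n) j j<r ⟩
        x j * ∑ _+_ 0# r (Q (suc n))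
          ≈⟨ *-congˡ (∑Q (suc n)) ⟩
        x j * ∑ _+_ 0# r (λ c → φ c * H (suc n) c)
          ≈⟨ *-congˡ (∑-cong r λ c _ → trans (*-congˡ (sym (Γ-suc n c j)))
               (solve 4 (λ p a b x → p :* (a :+ x :* b) := p :* a :+ x :* (p :* b)) refl
                 (φ c) (Γ (suc n) c j) (Γ n c j) (x j))) ⟩
        x j * ∑ _+_ 0# r (λ c → φ c * Γ (suc n) c j + x j * (φ c * Γ n c j))
          ≈⟨ *-congˡ (trans (∑-+ r _ _) (+-congˡ (∑-*ˡ r _ _))) ⟩
        x j * (∑ _+_ 0# r (λ c → φ c * Γ (suc n) c j) + x j * ∑ _+_ 0# r (λ c → φ c * Γ n c j))
          ≈⟨ distribˡ _ _ _ ⟩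
        x j * ∑ _+_ 0# r (λ c → φ c * Γ (suc n) c j) + x j * (x j * ∑ _+_ 0# r (λ c → φ c * Γ n c j))
          ≈⟨ +-congˡ (*-congˡ (Q-closed j j<r φj≈0 n)) ⟨
        x j * ∑ _+_ 0# r (λ c → φ c * Γ (suc n) c j) + x j * Q (suc n) j ∎)

    open Walk public

    -- Expansion of V in the families u k

    low : ℕ → ℕ → ℕ → ℕ → Carrier
    low j N k p = ∑ _+_ 0# p (λ l → ι (k ∸ suc l) * (e (N ∸ suc l) * u (suc l) j))

    high : ℕ → ℕ → ℕ → ℕ → Carrier
    high j N n p = ∑ _+_ 0# p (λ i → ι (n ∸ i) * (e i * u (N ∸ i) j))

    module _ (j : ℕ) (j<r : j < r) where

      -- The first row is chosen so that V-step holds from n = 0 on.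
      V : ℕ → ℕ → Carrier
      V k zero    = 0#
      V k (suc b) = x j * ∑≠ r j (λ c → u k c * g b c j)

      -- Inside the sum put e_k = h_k(c) + u_k(c). The part with x_c h_k(c) = u_{k+1}(c) gives V
      -- (k+1) n. The part with u_k(c) completes u_k(c) g_n to u_k(c) h_n(j), whose second factor
      -- leaves the sum. The term u_{n+1} u_k supplies the missing colour c = j, so that Euler's
      -- relation applies.
      V-step : ∀ k n → V k (suc n) + e k * V 1 n + u (suc n) j * u k j
                     ≈ V (suc k) n + ι k * (e k * u (suc n) j)
      V-step k zero = begin
        x j * ∑≠ r j (λ c → u k c * 1#) + e k * 0# + u 1 j * u k j
          ≈⟨ +-cong (trans (+-cong (*-congˡ (∑≠-cong r j λ c _ _ → *-identityʳ _)) (zeroʳ _))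
               (+-identityʳ _)) (*-congʳ (u-one j)) ⟩
        x j * ∑≠ r j (u k) + x j * u k j   ≈⟨ distribˡ _ _ _ ⟨
        x j * (∑≠ r j (u k) + u k j)       ≈⟨ *-congˡ (trans (∑≠-split r j (u k) j<r) (euler k)) ⟩
        x j * (ι k * e k)                  ≈⟨ solve 3 (λ x i e → x :* (i :* e) := i :* (e :* x)) refl _ _ _ ⟩
        ι k * (e k * x j)                  ≈⟨ *-congˡ (*-congˡ (u-one j)) ⟨
        ι k * (e k * u 1 j)                ≈⟨ +-identityˡ _ ⟨
        0# + ι k * (e k * u 1 j)           ∎
      V-step k (suc b) = begin
        x j * ∑≠ r j (λ c → u k c * g (suc b) c j)
          + e k * (x j * ∑≠ r j (λ c → u 1 c * g b c j)) + u (2 ℕ.+ b) j * u k j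
          ≈⟨ +-cong (trans (solve 4 (λ x a e b → x :* a :+ e :* (x :* b) := x :* (a :+ e :* b)) refl _ _ _ _)
               (*-congˡ (trans (+-congˡ (sym (∑≠-*ˡ r j _ _))) (sym (∑≠-+ r j _ _)))))
               (*-congʳ (u-suc (suc b) j)) ⟩
        x j * ∑≠ r j (λ c → u k c * g (suc b) c j + e k * (u 1 c * g b c j))
          + x j * h (suc b) j * u k j
          ≈⟨ +-congʳ (*-congˡ (∑≠-cong r j λ c _ _ → begin
               u k c * g (suc b) c j + e k * (u 1 c * g b c j)
                 ≈⟨ +-congˡ (*-cong (sym (e-split k c)) (*-congʳ (u-one c))) ⟩
               u k c * g (suc b) c j + (h k c + u k c) * (x c * g b c j)
                 ≈⟨ solve 5 (λ u h x g g′ → u :* g′ :+ (h :+ u) :* (x :* g)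
                      := (g′ :+ x :* g) :* u :+ x :* h :* g) refl
                      (u k c) (h k c) (x c) (g b c j) (g (suc b) c j) ⟩
               (g (suc b) c j + x c * g b c j) * u k c + x c * h k c * g b c j
                 ≈⟨ +-cong (*-congʳ (g-left b c j)) (*-congʳ (sym (u-suc k c))) ⟩
               h (suc b) j * u k c + u (suc k) c * g b c j ∎)) ⟩
        x j * ∑≠ r j (λ c → h (suc b) j * u k c + u (suc k) c * g b c j)
          + x j * h (suc b) j * u k j
          ≈⟨ +-congʳ (*-congˡ (trans (∑≠-+ r j _ _) (+-congʳ (∑≠-*ˡ r j _ _)))) ⟩
        x j * (h (suc b) j * ∑≠ r j (u k) + ∑≠ r j (λ c → u (suc k) c * g b c j))
          + x j * h (suc b) j * u k j
          ≈⟨ solve 5 (λ x h s t u → x :* (h :* s :+ t) :+ x :* h :* u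
                                := x :* t :+ (s :+ u) :* (x :* h)) refl _ _ _ _ _ ⟩
        V (suc k) (suc b) + (∑≠ r j (u k) + u k j) * (x j * h (suc b) j)
          ≈⟨ +-congˡ (*-cong (trans (∑≠-split r j (u k) j<r) (euler k)) (sym (u-suc (suc b) j))) ⟩
        V (suc k) (suc b) + ι k * e k * u (2 ℕ.+ b) j
          ≈⟨ +-congˡ (*-assoc _ _ _) ⟩
        V (suc k) (suc b) + ι k * (e k * u (2 ℕ.+ b) j) ∎

      -- Euler's relation in the variables other than x_j, deduced from the full one by induction on
      -- the degree.
      ∑xg : ∀ b → ∑≠ r j (λ c → x c * g b c j) ≈ ι (suc b) * h (suc b) j
      ∑xg zero = +-cancelʳ (x j) _ _ (begin
        ∑≠ r j (λ c → x c * 1#) + x j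
          ≈⟨ +-cong (∑≠-cong r j λ c _ _ → trans (*-identityʳ _) (sym (u-one c))) (sym (u-one j)) ⟩
        ∑≠ r j (u 1) + u 1 j   ≈⟨ trans (∑≠-split r j (u 1) j<r) (euler 1) ⟩
        ι 1 * e 1              ≈⟨ *-congˡ (e-split 1 j) ⟨
        ι 1 * (h 1 j + u 1 j)  ≈⟨ distribˡ _ _ _ ⟩
        ι 1 * h 1 j + ι 1 * u 1 j
          ≈⟨ +-congˡ (trans (*-cong (trans (ι-suc 0) (trans (+-congˡ ι-zero) (+-identityʳ _))) (u-one j)) (*-identityˡ _)) ⟩
        ι 1 * h 1 j + x j ∎)
      ∑xg (suc b) = +-cancelʳ (x j * (ι (suc b) * h (suc b) j) + x j * h (suc b) j) _ _ (begin
        ∑≠ r j (λ c → x c * g (suc b) c j) + (x j * (ι (suc b) * h (suc b) j) + x j * h (suc b) j)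
          ≈⟨ trans (sym (+-assoc _ _ _)) (+-congʳ (+-congˡ (trans (*-congˡ (sym (∑xg b))) (sym (∑≠-*ˡ r j _ _))))) ⟩
        ∑≠ r j (λ c → x c * g (suc b) c j) + ∑≠ r j (λ c → x j * (x c * g b c j)) + x j * h (suc b) j
          ≈⟨ +-congʳ (∑≠-+ r j _ _) ⟨
        ∑≠ r j (λ c → x c * g (suc b) c j + x j * (x c * g b c j)) + x j * h (suc b) j
          ≈⟨ +-cong (∑≠-cong r j λ c _ _ → trans
               (solve 4 (λ x g′ y g → x :* g′ :+ y :* (x :* g) := x :* (g′ :+ y :* g)) refl _ _ _ _)
               (trans (*-congˡ (g-right b c j)) (sym (u-suc (suc b) c)))) (sym (u-suc (suc b) j)) ⟩
        ∑≠ r j (u (2 ℕ.+ b)) + u (2 ℕ.+ b) j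
          ≈⟨ trans (∑≠-split r j _ j<r) (euler (2 ℕ.+ b)) ⟩
        ι (2 ℕ.+ b) * e (2 ℕ.+ b)
          ≈⟨ *-congˡ (h-suc (suc b) j) ⟨
        ι (2 ℕ.+ b) * (h (2 ℕ.+ b) j + x j * h (suc b) j)
          ≈⟨ distribˡ _ _ _ ⟩
        ι (2 ℕ.+ b) * h (2 ℕ.+ b) j + ι (2 ℕ.+ b) * (x j * h (suc b) j)
          ≈⟨ +-congˡ (trans (ι-suc-* (suc b) _)
               (+-congʳ (solve 3 (λ i x h → i :* (x :* h) := x :* (i :* h)) refl _ _ _))) ⟩
        ι (2 ℕ.+ b) * h (2 ℕ.+ b) j + (x j * (ι (suc b) * h (suc b) j) + x j * h (suc b) j) ∎)

      V-one : ∀ n → V 1 n ≈ ι n * u (suc n) j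
      V-one zero    = sym (trans (*-congʳ ι-zero) (zeroˡ _))
      V-one (suc b) = begin
        x j * ∑≠ r j (λ c → u 1 c * g b c j)
          ≈⟨ *-congˡ (∑≠-cong r j λ c _ _ → *-congʳ (u-one c)) ⟩
        x j * ∑≠ r j (λ c → x c * g b c j)
          ≈⟨ *-congˡ (∑xg b) ⟩
        x j * (ι (suc b) * h (suc b) j)
          ≈⟨ solve 3 (λ i x h → x :* (i :* h) := i :* (x :* h)) refl _ _ _ ⟩
        ι (suc b) * (x j * h (suc b) j)
          ≈⟨ *-congˡ (u-suc (suc b) j) ⟨
        ι (suc b) * u (2 ℕ.+ b) j ∎

      -- Going from V (k+1) n to V k (n+1) on one antidiagonal adds (k - n) e_k u_{n+1} - u_{n+1}
      -- u_k. The parts stay on separate sides because k - n has no fixed sign.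
      V-rec : ∀ k n → V k (suc n) + ι n * (e k * u (suc n) j) + u (suc n) j * u k j
                    ≈ V (suc k) n + ι k * (e k * u (suc n) j)
      V-rec k n = trans (+-congʳ (+-congˡ (sym (trans (*-congˡ (V-one n))
        (solve 3 (λ e i u → e :* (i :* u) := i :* (e :* u)) refl _ _ _))))) (V-step k n)

      -- With e = h + u and u_{m+1} = x_j h_m, both sides contain x_j h_n h_k and the rest agrees.
      -- Iterating it lowers the first index of a product u u until u_0 = 0, leaving only terms e u.
      uu-shift : ∀ n k → u (suc n) j * u k j + e n * u (suc k) j ≈ u n j * u (suc k) j + u (suc n) j * e k
      uu-shift n k = begin
        u (suc n) j * u k j + e n * u (suc k) j
          ≈⟨ +-cong (*-congʳ (u-suc n j)) (*-cong (sym (e-split n j)) (u-suc k j)) ⟩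
        x j * h n j * u k j + (h n j + u n j) * (x j * h k j)
          ≈⟨ solve 5 (λ x h u h′ u′ → x :* h :* u′ :+ (h :+ u) :* (x :* h′)
                                   := u :* (x :* h′) :+ x :* h :* (h′ :+ u′)) refl _ _ _ _ _ ⟩
        u n j * (x j * h k j) + x j * h n j * (h k j + u k j)
          ≈⟨ +-cong (*-congˡ (sym (u-suc k j))) (*-cong (sym (u-suc n j)) (e-split k j)) ⟩
        u n j * u (suc k) j + u (suc n) j * e k ∎

      -- For n > k the terms with index ≥ k occur on both sides.
      uu-expand : ∀ n k N → n ℕ.+ k ≡ N →
        u n j * u k j + ∑ _+_ 0# n (λ i → e i * u (N ∸ i) j)
          ≈ ∑ _+_ 0# n (λ l → e (N ∸ suc l) * u (suc l) j)
      uu-expand zero    k N eq = trans (+-identityʳ _) (trans (*-congʳ (u-zero j)) (zeroˡ _))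
      uu-expand (suc n) k .(suc n ℕ.+ k) ≡.refl = begin
        u (suc n) j * u k j + (∑ _+_ 0# n (λ i → e i * u (suc n ℕ.+ k ∸ i) j) + e n * u (suc n ℕ.+ k ∸ n) j)
          ≈⟨ +-congˡ (+-congˡ (*-congˡ (reflexive (≡.cong (λ m → u m j)
               (≡.trans (≡.cong (_∸ n) (≡.sym (ℕₚ.+-suc n k))) (ℕₚ.m+n∸m≡n n (suc k))))))) ⟩
        u (suc n) j * u k j + (∑ _+_ 0# n (λ i → e i * u (suc n ℕ.+ k ∸ i) j) + e n * u (suc k) j)
          ≈⟨ solve 3 (λ a s b → a :+ (s :+ b) := a :+ b :+ s) refl _ _ _ ⟩
        u (suc n) j * u k j + e n * u (suc k) j + ∑ _+_ 0# n (λ i → e i * u (suc n ℕ.+ k ∸ i) j)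
          ≈⟨ +-congʳ (uu-shift n k) ⟩
        u n j * u (suc k) j + u (suc n) j * e k + ∑ _+_ 0# n (λ i → e i * u (suc n ℕ.+ k ∸ i) j)
          ≈⟨ solve 3 (λ a s b → a :+ b :+ s := a :+ s :+ b) refl _ _ _ ⟩
        u n j * u (suc k) j + ∑ _+_ 0# n (λ i → e i * u (suc n ℕ.+ k ∸ i) j) + u (suc n) j * e k
          ≈⟨ +-cong (uu-expand n (suc k) (suc n ℕ.+ k) (ℕₚ.+-suc n k))
               (trans (*-comm _ _) (*-congʳ (reflexive (≡.cong e (≡.sym (ℕₚ.m+n∸m≡n n k)))))) ⟩
        ∑ _+_ 0# (suc n) (λ l → e (suc n ℕ.+ k ∸ suc l) * u (suc l) j) ∎

      ∑-ι-suc : ∀ p (c c′ : ℕ → ℕ) (t : ℕ → Carrier) → (∀ i → i < p → c i ≡ suc (c′ i)) →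
        ∑ _+_ 0# p (λ i → ι (c i) * t i) ≈ ∑ _+_ 0# p (λ i → ι (c′ i) * t i) + ∑ _+_ 0# p t
      ∑-ι-suc p c c′ t eq = trans
        (∑-cong p λ i i<p → trans (*-congʳ (reflexive (≡.cong ι (eq i i<p)))) (ι-suc-* (c′ i) (t i)))
        (∑-+ p _ _)

      -- Each coefficient k - (l + 1) grows by exactly 1; `p ≤ k` guarantees that no subtraction is
      -- truncated.
      low-suc : ∀ N k p → p ≤ k →
        low j N (suc k) p ≈ low j N k p + ∑ _+_ 0# p (λ l → e (N ∸ suc l) * u (suc l) j)
      low-suc N (suc k) p p≤k = ∑-ι-suc p _ _ _ λ l l<p → ℕₚ.+-∸-assoc 1 (ℕₚ.≤-pred (ℕₚ.<-≤-trans l<p p≤k))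
      low-suc N zero zero z≤n = sym (+-identityʳ 0#)

      high-suc : ∀ N n p → p ≤ suc n →
        high j N (suc n) p ≈ high j N n p + ∑ _+_ 0# p (λ i → e i * u (N ∸ i) j)
      high-suc N n p p≤1+n = ∑-ι-suc p _ _ _ λ i i<p → ℕₚ.+-∸-assoc 1 (ℕₚ.≤-pred (ℕₚ.<-≤-trans i<p p≤1+n))

      ι-self : ∀ n {a} → ι (n ∸ n) * a ≈ 0#
      ι-self n = trans (*-congʳ (trans (reflexive (≡.cong ι (ℕₚ.n∸n≡0 n))) ι-zero)) (zeroˡ _)

      ι-∸ : ∀ {m n} a → n ≤ m → ι (m ∸ n) * a + ι n * a ≈ ι m * a
      ι-∸ {m} {n} a n≤m = trans (sym (distribʳ a _ _)) (*-congʳ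
        (trans (sym (ι-+ (m ∸ n) n)) (reflexive (≡.cong ι (ℕₚ.m∸n+n≡m n≤m)))))

      -- Induction on n, from V N 0 = 0. In the step, (k - n) e_k u_{n+1} is the next summand of
      -- `low`, and -u u = E - L lowers the coefficients of `low` by 1 and raises those of `high` by
      -- 1. Since n + 1 ≤ k, those of `low` stay nonnegative.
      V-n≤k : ∀ n k N → n ≤ k → n ℕ.+ k ≡ N → V k n ≈ low j N k n + high j N n n
      V-n≤k zero    k N _ _ = sym (+-identityʳ 0#)
      V-n≤k (suc n) k .(suc n ℕ.+ k) 1+n≤k ≡.refl =
        +-cancelʳ (ι n * t + u (suc n) j * u k j + E) _ _ (begin
          V k (suc n) + (ι n * t + u (suc n) j * u k j + E)
            ≈⟨ solve 4 (λ v a b c → v :+ (a :+ b :+ c) := v :+ a :+ b :+ c) refl _ _ _ _ ⟩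
          V k (suc n) + ι n * t + u (suc n) j * u k j + E
            ≈⟨ +-congʳ (V-rec k n) ⟩
          V (suc k) n + ι k * t + E
            ≈⟨ +-congʳ (+-congʳ (V-n≤k n (suc k) N (ℕₚ.≤-trans (ℕₚ.n≤1+n n) (ℕₚ.m≤n⇒m≤1+n 1+n≤k)) (ℕₚ.+-suc n k))) ⟩
          low j N (suc k) n + high j N n n + ι k * t + E
            ≈⟨ +-congʳ (+-congˡ (ι-∸ t (ℕₚ.≤-trans (ℕₚ.n≤1+n n) 1+n≤k))) ⟨
          low j N (suc k) n + high j N n n + (ι (k ∸ n) * t + ι n * t) + E
            ≈⟨ +-congʳ (+-congˡ (+-congʳ (*-congˡ (*-congʳ (reflexive (≡.cong e (ℕₚ.m+n∸m≡n (suc n) k))))))) ⟨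
          low j N (suc k) n + high j N n n + (ι (k ∸ n) * (e (N ∸ suc n) * u (suc n) j) + ι n * t) + E
            -- `suc k ∸ suc n` reduces to `k ∸ n`, so the split-off term is literally the last
            -- summand of `low` with k + 1.
            ≈⟨ solve 5 (λ l h a b c → l :+ h :+ (a :+ b) :+ c := l :+ a :+ (h :+ c) :+ b) refl _ _ _ _ _ ⟩
          low j N (suc k) (suc n) + (high j N n n + E) + ι n * t
            -- `high` may be lengthened to n + 1 summands, the new one having coefficient n - n = 0.
            ≈⟨ +-congʳ (+-cong (low-suc N k (suc n) 1+n≤k)
                 (+-congʳ (sym (trans (+-congˡ (ι-self n)) (+-identityʳ _))))) ⟩
          low j N k (suc n) + L + (high j N n (suc n) + E) + ι n * t
            ≈⟨ +-congʳ (+-cong (+-congˡ (sym (uu-expand (suc n) k N ≡.refl))) (sym (high-suc N n (suc n) ℕₚ.≤-refl))) ⟩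
          low j N k (suc n) + (u (suc n) j * u k j + E) + high j N (suc n) (suc n) + ι n * t
            ≈⟨ solve 5 (λ l a c h b → l :+ (a :+ c) :+ h :+ b := l :+ h :+ (b :+ a :+ c)) refl _ _ _ _ _ ⟩
          low j N k (suc n) + high j N (suc n) (suc n) + (ι n * t + u (suc n) j * u k j + E) ∎)
        where
        N = suc n ℕ.+ k
        t = e k * u (suc n) j
        E = ∑ _+_ 0# (suc n) (λ i → e i * u (N ∸ i) j)
        L = ∑ _+_ 0# (suc n) (λ l → e (N ∸ suc l) * u (suc l) j)

      -- The mirror image, by induction on k from V 0 N = 0: now (n - k) e_k u_{n+1} is the next
      -- summand of `high`, and u u = L - E raises `low` and lowers `high`.
      V-k≤n : ∀ k n N → k ≤ n → k ℕ.+ n ≡ N → V k n ≈ low j N k k + high j N n k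
      V-k≤n zero    zero    N _ _ = sym (+-identityʳ 0#)
      V-k≤n zero    (suc n) N _ _ = begin
        x j * ∑≠ r j (λ c → u 0 c * g n c j)
          ≈⟨ *-congˡ (trans (∑≠-cong r j λ c _ _ → trans (*-congʳ (u-zero c))
               (trans (zeroˡ _) (sym (zeroˡ 0#)))) (trans (∑≠-*ˡ r j 0# _) (zeroˡ _))) ⟩
        x j * 0# ≈⟨ zeroʳ _ ⟩
        0#       ≈⟨ +-identityʳ 0# ⟨
        0# + 0#  ∎
      V-k≤n (suc k) n .(suc k ℕ.+ n) 1+k≤n ≡.refl =
        +-cancelʳ (ι k * t + E) _ _ (begin
          V (suc k) n + (ι k * t + E)
            ≈⟨ +-assoc _ _ _ ⟨
          V (suc k) n + ι k * t + E
            ≈⟨ +-congʳ (V-rec k n) ⟨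
          V k (suc n) + ι n * t + u (suc n) j * u k j + E
            ≈⟨ solve 4 (λ v a b c → v :+ a :+ b :+ c := v :+ a :+ (b :+ c)) refl _ _ _ _ ⟩
          V k (suc n) + ι n * t + (u (suc n) j * u k j + E)
            ≈⟨ +-cong (+-cong (V-k≤n k (suc n) N (ℕₚ.≤-trans (ℕₚ.n≤1+n k) (ℕₚ.m≤n⇒m≤1+n 1+k≤n)) (ℕₚ.+-suc k n))
                 (sym (ι-∸ t (ℕₚ.≤-trans (ℕₚ.n≤1+n k) 1+k≤n))))
                 (trans (+-congʳ (*-comm _ _)) (uu-expand k (suc n) N (ℕₚ.+-suc k n))) ⟩
          low j N k k + high j N (suc n) k + (ι (n ∸ k) * t + ι k * t) + L
            ≈⟨ +-congʳ (+-cong (+-congˡ (high-suc N n k (ℕₚ.≤-trans (ℕₚ.n≤1+n k) (ℕₚ.m≤n⇒m≤1+n 1+k≤n))))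
                 (+-congʳ (*-congˡ (*-congˡ (reflexive (≡.cong (λ m → u m j) (≡.sym N∸k≡1+n))))))) ⟩
          low j N k k + (high j N n k + E) + (ι (n ∸ k) * (e k * u (N ∸ k) j) + ι k * t) + L
            ≈⟨ solve 6 (λ l h c a b m → l :+ (h :+ c) :+ (a :+ b) :+ m := l :+ m :+ (h :+ a) :+ (b :+ c)) refl _ _ _ _ _ _ ⟩
          low j N k k + L + high j N n (suc k) + (ι k * t + E)
            ≈⟨ +-congʳ (+-congʳ (trans (sym (low-suc N k k ℕₚ.≤-refl))
                 (sym (trans (+-congˡ (ι-self k)) (+-identityʳ _))))) ⟩
          low j N (suc k) (suc k) + high j N n (suc k) + (ι k * t + E) ∎)
        where
        N = suc k ℕ.+ n
        t = e k * u (suc n) j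
        E = ∑ _+_ 0# k (λ i → e i * u (N ∸ i) j)
        L = ∑ _+_ 0# k (λ l → e (N ∸ suc l) * u (suc l) j)
        N∸k≡1+n : N ∸ k ≡ suc n
        N∸k≡1+n = ≡.trans (≡.cong (_∸ k) (≡.sym (ℕₚ.+-suc k n))) (ℕₚ.m+n∸m≡n k (suc n))

      V-closed : ∀ k n → V k n ≈ low j (k ℕ.+ n) k (k ⊓ n) + high j (k ℕ.+ n) n (k ⊓ n)
      V-closed k n with ℕₚ.≤-total k n
      ... | inj₁ k≤n rewrite ℕₚ.m≤n⇒m⊓n≡m k≤n = V-k≤n k n (k ℕ.+ n) k≤n ≡.refl
      ... | inj₂ n≤k rewrite ℕₚ.m≥n⇒m⊓n≡n n≤k = V-n≤k n k (k ℕ.+ n) n≤k (ℕₚ.+-comm n k)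

    -- The attaching operator, linear in F

    attached : (ℕ → Carrier) → ℕ → ℕ → Carrier
    attached F n j = x j * ∑≠ r j (λ c → F c * Γ n c j)

    -- Deleting the colour j from F encodes the closing edge of the cycle, and it is also what
    -- `Q-closed` asks of φ.
    Q-attached : ∀ (F : ℕ → Carrier) n j → j < r →
      Q (λ c → unless (c ℕ.≟ j) (F c)) (suc n) j ≈ attached F n j
    Q-attached F n j j<r = trans (Q-closed _ j j<r (unless-yes (j ℕ.≟ j) ≡.refl) n)
      (*-congˡ (∑-cong r λ c _ → trans (*-comm _ _)
        (trans (sym (unless-*ˡ (c ℕ.≟ j) _ _)) (unless-cong (c ℕ.≟ j) λ _ → *-comm _ _))))

    attached-cong : ∀ {F G : ℕ → Carrier} n j → (∀ c → c < r → F c ≈ G c) → attached F n j ≈ attached G n j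
    attached-cong n j eq = *-congˡ (∑≠-cong r j λ c c<r _ → *-congʳ (eq c c<r))

    attached-0 : ∀ n j → attached (λ _ → 0#) n j ≈ 0#
    attached-0 n j = trans (*-congˡ (trans (∑≠-*ˡ r j 0# _) (zeroˡ _))) (zeroʳ _)

    attached-+ : ∀ (F G : ℕ → Carrier) n j →
      attached (λ c → F c + G c) n j ≈ attached F n j + attached G n j
    attached-+ F G n j = trans
      (*-congˡ (trans (∑≠-cong r j λ c _ _ → distribʳ _ _ _) (∑≠-+ r j _ _))) (distribˡ _ _ _)

    attached-* : ∀ f (F : ℕ → Carrier) n j → attached (λ c → f * F c) n j ≈ f * attached F n j
    attached-* f F n j = begin
      x j * ∑≠ r j (λ c → f * F c * Γ n c j)
        ≈⟨ *-congˡ (trans (∑≠-cong r j λ c _ _ → *-assoc _ _ _) (∑≠-*ˡ r j f _)) ⟩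
      x j * (f * ∑≠ r j (λ c → F c * Γ n c j))
        ≈⟨ solve 3 (λ x f s → x :* (f :* s) := f :* (x :* s)) refl _ _ _ ⟩
      f * (x j * ∑≠ r j (λ c → F c * Γ n c j)) ∎

    attached-u : ∀ k n j → j < r → attached (u k) n j
      ≈ conv _+_ n (λ a b → w a * (low j (k ℕ.+ suc b) k (k ⊓ suc b) + high j (k ℕ.+ suc b) (suc b) (k ⊓ suc b)))
    attached-u k n j j<r = begin
      x j * ∑≠ r j (λ c → u k c * Γ n c j)
        ≈⟨ *-congˡ (∑≠-cong r j λ c _ _ → conv-*ˡ n (u k c) _) ⟨
      x j * ∑≠ r j (λ c → conv _+_ n (λ a b → u k c * (w a * g b c j)))
        ≈⟨ *-congˡ (∑≠-conv r j n _) ⟩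
      x j * conv _+_ n (λ a b → ∑≠ r j (λ c → u k c * (w a * g b c j)))
        ≈⟨ conv-*ˡ n (x j) _ ⟨
      conv _+_ n (λ a b → x j * ∑≠ r j (λ c → u k c * (w a * g b c j)))
        ≈⟨ conv-cong n (λ a b _ → begin
             x j * ∑≠ r j (λ c → u k c * (w a * g b c j))
               ≈⟨ *-congˡ (∑≠-cong r j λ c _ _ → solve 3 (λ u w g → u :* (w :* g) := w :* (u :* g)) refl _ _ _) ⟩
             x j * ∑≠ r j (λ c → w a * (u k c * g b c j))
               ≈⟨ *-congˡ (∑≠-*ˡ r j (w a) _) ⟩
             x j * (w a * ∑≠ r j (λ c → u k c * g b c j))
               ≈⟨ solve 3 (λ x w s → x :* (w :* s) := w :* (x :* s)) refl _ _ _ ⟩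
             w a * V j j<r k (suc b)
               ≈⟨ *-congˡ (V-closed j j<r k (suc b)) ⟩
             w a * (low j (k ℕ.+ suc b) k (k ⊓ suc b) + high j (k ℕ.+ suc b) (suc b) (k ⊓ suc b)) ∎) ⟩
      conv _+_ n (λ a b → w a * (low j (k ℕ.+ suc b) k (k ⊓ suc b) + high j (k ℕ.+ suc b) (suc b) (k ⊓ suc b))) ∎

open ≡ using (refl; sym; trans; cong; cong₂; subst; ≢-sym)
open import Defs

-- The ring of series

module ℤΣ = RingSums ℤₚ.+-*-commutativeRing

sumℤ-++ : ∀ xs ys → sumℤ (xs ++ ys) ≡ sumℤ xs ℤ.+ sumℤ ys
sumℤ-++ []       ys = sym (ℤₚ.+-identityˡ _)
sumℤ-++ (x ∷ xs) ys = trans (cong (ℤ._+_ x) (sumℤ-++ xs ys)) (sym (ℤₚ.+-assoc x _ _))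

sumℤ-map-cong : ∀ {A : Set} (xs : List A) {f g : A → ℤ} → (∀ x → f x ≡ g x) →
  sumℤ (map f xs) ≡ sumℤ (map g xs)
sumℤ-map-cong []       eq = refl
sumℤ-map-cong (x ∷ xs) eq = cong₂ ℤ._+_ (eq x) (sumℤ-map-cong xs eq)

sumℤ-cartesianProductWith : ∀ {A B C : Set} (F : C → ℤ) (f : A → B → C) xs ys →
  sumℤ (map F (cartesianProductWith f xs ys)) ≡ sumℤ (map (λ x → sumℤ (map (λ y → F (f x y)) ys)) xs)
sumℤ-cartesianProductWith F f []       ys = refl
sumℤ-cartesianProductWith F f (x ∷ xs) ys = begin
  sumℤ (map F (map (f x) ys ++ cartesianProductWith f xs ys))
    ≡⟨ cong sumℤ (map-++ F (map (f x) ys) _) ⟩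
  sumℤ (map F (map (f x) ys) ++ map F (cartesianProductWith f xs ys))
    ≡⟨ sumℤ-++ (map F (map (f x) ys)) _ ⟩
  sumℤ (map F (map (f x) ys)) ℤ.+ sumℤ (map F (cartesianProductWith f xs ys))
    ≡⟨ cong₂ ℤ._+_ (cong sumℤ (sym (map-∘ ys))) (sumℤ-cartesianProductWith F f xs ys) ⟩
  sumℤ (map (λ y → F (f x y)) ys) ℤ.+ sumℤ (map (λ x → sumℤ (map (λ y → F (f x y)) ys)) xs) ∎
  where open ≡.≡-Reasoning

sumℤ-upTo-conv : ∀ n (G : ℕ → ℕ → ℤ) →
  sumℤ (map (λ j → G j (n ∸ j)) (upTo (suc n))) ≡ conv ℤ._+_ n G
sumℤ-upTo-conv n G = trans (cong sumℤ (map-applyUpTo id (λ j → G j (n ∸ j)) (suc n))) (go n G)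
  where
  go : ∀ n (G : ℕ → ℕ → ℤ) → sumℤ (applyUpTo (λ j → G j (n ∸ j)) (suc n)) ≡ conv ℤ._+_ n G
  go zero    G = ℤₚ.+-identityʳ _
  go (suc n) G = cong (ℤ._+_ (G 0 (suc n))) (go n (λ i → G (suc i)))

sumℤ-upTo : ∀ n (f : ℕ → ℤ) → sumℤ (map f (upTo n)) ≡ ∑ ℤ._+_ 0ℤ n f
sumℤ-upTo n f = trans (cong sumℤ (map-applyUpTo id f n)) (go n f)
  where
  go : ∀ n (f : ℕ → ℤ) → sumℤ (applyUpTo f n) ≡ ∑ ℤ._+_ 0ℤ n f
  go zero    f = refl
  go (suc n) f = trans (cong (ℤ._+_ (f 0)) (go n (f ∘ suc))) (sym (ℤΣ.∑-head n f))

infixl 8 _at_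
_at_ : Series → ℕ → Series
f at i = f ∘ (i ∷_)

infixl 6 _⊞_
_⊞_ : Series → Series → Series
(f ⊞ g) α = f α ℤ.+ g α

𝟘 : Series
𝟘 _ = 0ℤ

⊟_ : Series → Series
(⊟ f) α = ℤ.- f α

·-[] : ∀ f g → (f · g) [] ≡ f [] ℤ.* g []
·-[] f g = ℤₚ.+-identityʳ _

-- Fixing the exponent of the first variable turns the product into a convolution of products in the
-- remaining variables; the ring laws follow from this by induction on the exponent list.
·-∷ : ∀ f g n α → (f · g) (n ∷ α) ≡ conv ℤ._+_ n (λ i j → ((f at i) · (g at j)) α)
·-∷ f g n α = trans
  (sumℤ-cartesianProductWith _ _ (upTo (suc n)) (factorizations α))
  (sumℤ-upTo-conv n (λ i j → ((f at i) · (g at j)) α))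

-- A product at α reads its factors only at lists of the same length. This makes `_≈[ r ]_`
-- compatible with multiplication.
·-cong-length : ∀ α {f f′ g g′} →
  (∀ β → length β ≡ length α → f β ≡ f′ β) → (∀ β → length β ≡ length α → g β ≡ g′ β) →
  (f · g) α ≡ (f′ · g′) α
·-cong-length []      {f} {f′} {g} {g′} f≈ g≈ = trans (·-[] f g) (trans (cong₂ ℤ._*_ (f≈ [] refl) (g≈ [] refl)) (sym (·-[] f′ g′)))
·-cong-length (n ∷ α) {f} {f′} {g} {g′} f≈ g≈ = trans (·-∷ f g n α) (trans
  (ℤΣ.conv-cong n λ i j _ → ·-cong-length α (λ β eq → f≈ (i ∷ β) (cong suc eq)) (λ β eq → g≈ (j ∷ β) (cong suc eq)))
  (sym (·-∷ f′ g′ n α)))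

·-congʳ : ∀ {f f′} g → f ≈ f′ → f · g ≈ f′ · g
·-congʳ {f} {f′} g eq α = ·-cong-length α {f} {f′} {g} {g} (λ β _ → eq β) (λ _ _ → refl)

·-congˡ : ∀ f {g g′} → g ≈ g′ → f · g ≈ f · g′
·-congˡ f {g} {g′} eq α = ·-cong-length α {f} {f} {g} {g′} (λ _ _ → refl) (λ β _ → eq β)

·-comm : ∀ f g → f · g ≈ g · f
·-comm f g []      = trans (·-[] f g) (trans (ℤₚ.*-comm (f []) _) (sym (·-[] g f)))
·-comm f g (n ∷ α) = trans (·-∷ f g n α) (trans
  (ℤΣ.conv-cong n λ i j _ → ·-comm (f at i) (g at j) α) (trans
  (ℤΣ.conv-flip n (λ i j → ((g at j) · (f at i)) α)) (sym (·-∷ g f n α))))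

·-distribˡ : ∀ f g k → f · (g ⊞ k) ≈ f · g ⊞ f · k
·-distribˡ f g k []      = trans (·-[] f (g ⊞ k)) (trans (ℤₚ.*-distribˡ-+ (f []) _ _)
  (sym (cong₂ ℤ._+_ (·-[] f g) (·-[] f k))))
·-distribˡ f g k (n ∷ α) = trans (·-∷ f (g ⊞ k) n α) (trans
  (ℤΣ.conv-cong n λ i j _ → ·-distribˡ (f at i) (g at j) (k at j) α) (trans
  (ℤΣ.conv-+ n _ _) (sym (cong₂ ℤ._+_ (·-∷ f g n α) (·-∷ f k n α)))))

·-distribʳ : ∀ f g k → (g ⊞ k) · f ≈ g · f ⊞ k · f
·-distribʳ f g k α = trans (·-comm (g ⊞ k) f α) (trans (·-distribˡ f g k α)
  (cong₂ ℤ._+_ (·-comm f g α) (·-comm f k α)))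

·-zeroˡ : ∀ f → 𝟘 · f ≈ 𝟘
·-zeroˡ f α = go (factorizations α)
  where
  go : ∀ xs → sumℤ (map (λ (β , γ) → 0ℤ ℤ.* f γ) xs) ≡ 0ℤ
  go []             = refl
  go ((β , γ) ∷ xs) = trans (cong₂ ℤ._+_ (ℤₚ.*-zeroˡ (f γ)) (go xs)) refl

conv-· : ∀ m (S : ℕ → ℕ → Series) f →
  (λ α → conv ℤ._+_ m (λ i j → S i j α)) · f ≈ (λ α → conv ℤ._+_ m (λ i j → (S i j · f) α))
conv-· zero    S f α = refl
conv-· (suc m) S f α = trans (·-distribʳ f (S 0 (suc m)) _ α)
  (cong (ℤ._+_ ((S 0 (suc m) · f) α)) (conv-· m (λ i → S (suc i)) f α))

·-conv : ∀ m (S : ℕ → ℕ → Series) f →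
  f · (λ α → conv ℤ._+_ m (λ i j → S i j α)) ≈ (λ α → conv ℤ._+_ m (λ i j → (f · S i j) α))
·-conv m S f α = trans (·-comm f _ α) (trans (conv-· m S f α)
  (ℤΣ.conv-cong m λ i j _ → ·-comm (S i j) f α))

·-assoc : ∀ f g k → (f · g) · k ≈ f · (g · k)
·-assoc f g k [] = begin
  ((f · g) · k) []               ≡⟨ ·-[] (f · g) k ⟩
  (f · g) [] ℤ.* k []            ≡⟨ cong (ℤ._* k []) (·-[] f g) ⟩
  f [] ℤ.* g [] ℤ.* k []         ≡⟨ ℤₚ.*-assoc (f []) (g []) (k []) ⟩
  f [] ℤ.* (g [] ℤ.* k [])       ≡⟨ cong (ℤ._*_ (f [])) (·-[] g k) ⟨
  f [] ℤ.* (g · k) []            ≡⟨ ·-[] f (g · k) ⟨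
  (f · (g · k)) []               ∎
  where open ≡.≡-Reasoning
·-assoc f g k (n ∷ α) = begin
  ((f · g) · k) (n ∷ α)
    ≡⟨ ·-∷ (f · g) k n α ⟩
  conv ℤ._+_ n (λ m l → (((f · g) ∘ (m ∷_)) · k at l) α)
    ≡⟨ ℤΣ.conv-cong n (λ m l _ → trans (·-congʳ (k at l) (·-∷ f g m) α) (conv-· m _ (k at l) α)) ⟩
  conv ℤ._+_ n (λ m l → conv ℤ._+_ m (λ i j → ((f at i · g at j) · k at l) α))
    ≡⟨ ℤΣ.conv-cong n (λ m l _ → ℤΣ.conv-cong m λ i j _ → ·-assoc (f at i) (g at j) (k at l) α) ⟩
  conv ℤ._+_ n (λ m l → conv ℤ._+_ m (λ i j → (f at i · (g at j · k at l)) α))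
    ≡⟨ ℤΣ.conv-assoc n (λ i j l → (f at i · (g at j · k at l)) α) ⟩
  conv ℤ._+_ n (λ i m → conv ℤ._+_ m (λ j l → (f at i · (g at j · k at l)) α))
    ≡⟨ ℤΣ.conv-cong n (λ i m _ → trans (·-congˡ (f at i) (·-∷ g k m) α) (·-conv m _ (f at i) α)) ⟨
  conv ℤ._+_ n (λ i m → (f at i · ((g · k) ∘ (m ∷_))) α)
    ≡⟨ ·-∷ f (g · k) n α ⟨
  (f · (g · k)) (n ∷ α) ∎
  where
  open ≡.≡-Reasoning

conv-head : ∀ n {G : ℕ → ℕ → ℤ} → (∀ i j → G (suc i) j ≡ 0ℤ) → conv ℤ._+_ n G ≡ G 0 n
conv-head zero    eq = refl
conv-head (suc n) {G} eq = trans
  (cong (ℤ._+_ (G 0 (suc n))) (trans (conv-head n {λ i → G (suc i)} (λ i → eq (suc i))) (eq 0 n)))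
  (ℤₚ.+-identityʳ _)

·-identityˡ : ∀ f → 𝟙 · f ≈ f
·-identityˡ f []      = trans (·-[] 𝟙 f) (ℤₚ.*-identityˡ _)
·-identityˡ f (n ∷ α) = trans (·-∷ 𝟙 f n α) (trans
  -- `𝟙 at 0` reduces to `𝟙` and `𝟙 at suc i` to `𝟘`, so only the first term of the convolution
  -- survives.
  (conv-head n λ i j → ·-zeroˡ (f ∘ (j ∷_)) α) (·-identityˡ (f ∘ (n ∷_)) α))

infix 4 _≈[_]_
-- Equality after restriction to r variables. The restriction is put into the relation and not into
-- the carrier, so that one series can be the witness for all r.
_≈[_]_ : Series → ℕ → Series → Set
f ≈[ r ] g = ∀ α → length α ≡ r → f α ≡ g α

seriesRing : ℕ → CommutativeRing 0ℓ 0ℓ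
seriesRing r = record
  { Carrier = Series ; _≈_ = _≈[ r ]_ ; _+_ = _⊞_ ; _*_ = _·_ ; -_ = ⊟_ ; 0# = 𝟘 ; 1# = 𝟙
  ; isCommutativeRing = record
    { isRing = record
      { +-isAbelianGroup = record
        { isGroup = record
          { isMonoid = record
            { isSemigroup = record
              { isMagma = record
                { isEquivalence = record
                  { refl  = λ _ _ → refl
                  ; sym   = λ p α eq → sym (p α eq)
                  ; trans = λ p q α eq → trans (p α eq) (q α eq) }
                ; ∙-cong = λ p q α eq → cong₂ ℤ._+_ (p α eq) (q α eq) }
              ; assoc = λ f g k α _ → ℤₚ.+-assoc (f α) (g α) (k α) }
            ; identity = (λ f α _ → ℤₚ.+-identityˡ (f α)) , (λ f α _ → ℤₚ.+-identityʳ (f α)) }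
          ; inverse = (λ f α _ → ℤₚ.+-inverseˡ (f α)) , (λ f α _ → ℤₚ.+-inverseʳ (f α))
          ; ⁻¹-cong = λ p α eq → cong ℤ.-_ (p α eq) }
        ; comm = λ f g α _ → ℤₚ.+-comm (f α) (g α) }
      ; *-cong = λ {f} {f′} {g} {g′} p q α eq → ·-cong-length α {f} {f′} {g} {g′}
          (λ β eq′ → p β (trans eq′ eq)) (λ β eq′ → q β (trans eq′ eq))
      ; *-assoc = λ f g k α _ → ·-assoc f g k α
      ; *-identity = (λ f α _ → ·-identityˡ f α)
                   , (λ f α _ → trans (·-comm f 𝟙 α) (·-identityˡ f α))
      ; distrib = (λ f g k α _ → ·-distribˡ f g k α) , (λ f g k α _ → ·-distribʳ f g k α) }
    ; *-comm = λ f g α _ → ·-comm f g α } }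

-- Variables and elementary symmetric functions as series

∑-coeff : ∀ n (F : ℕ → Series) α → ∑ _⊞_ 𝟘 n F α ≡ ∑ ℤ._+_ 0ℤ n (λ i → F i α)
∑-coeff zero    F α = refl
∑-coeff (suc n) F α = cong (ℤ._+ F n α) (∑-coeff n F α)

var : ℕ → Series
var _       []                = 0ℤ
var zero    (suc zero ∷ α)    = 𝟙 α
var zero    (_ ∷ α)           = 0ℤ
var (suc j) (zero ∷ α)        = var j α
var (suc j) (suc _ ∷ α)       = 0ℤ

-- Multiplication by x_j as a shift of exponents (see `var-·`), which evaluates by pattern matching
-- where the product is a sum.
raise : ℕ → Series → Series
raise j       f []          = 0ℤ
raise zero    f (zero ∷ α)  = 0ℤ
raise zero    f (suc n ∷ α) = f (n ∷ α)
raise (suc j) f (n ∷ α)     = raise j (f ∘ (n ∷_)) α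

raise-cong : ∀ j {f g} → f ≈ g → raise j f ≈ raise j g
raise-cong j       eq []          = refl
raise-cong zero    eq (zero ∷ α)  = refl
raise-cong zero    eq (suc n ∷ α) = eq (n ∷ α)
raise-cong (suc j) eq (n ∷ α)     = raise-cong j (eq ∘ (n ∷_)) α

raise-𝟘 : ∀ j → raise j 𝟘 ≈ 𝟘
raise-𝟘 j       []          = refl
raise-𝟘 zero    (zero ∷ α)  = refl
raise-𝟘 zero    (suc n ∷ α) = refl
raise-𝟘 (suc j) (n ∷ α)     = raise-𝟘 j α

var-· : ∀ j f → var j · f ≈ raise j f
var-· j       f []          = trans (·-[] (var j) f) (ℤₚ.*-zeroˡ (f []))
var-· zero    f (zero ∷ α)  = trans (·-∷ (var zero) f 0 α) (·-zeroˡ (f ∘ (0 ∷_)) α)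
var-· zero    f (suc n ∷ α) = trans (·-∷ (var zero) f (suc n) α) (trans
  (cong₂ ℤ._+_ (·-zeroˡ (f ∘ (suc n ∷_)) α) (conv-head n λ i j → ·-zeroˡ (f ∘ (j ∷_)) α))
  (trans (ℤₚ.+-identityˡ _) (·-identityˡ (f ∘ (n ∷_)) α)))
var-· (suc j) f (n ∷ α)     = trans (·-∷ (var (suc j)) f n α) (trans
  (conv-head n λ i k → ·-zeroˡ (f ∘ (k ∷_)) α) (var-· j (f ∘ (n ∷_)) α))

-- Out of range the value is 0, in agreement with the convention on trailing zeros.
_‼_ : List ℕ → ℕ → ℕ
[]      ‼ _     = 0
(n ∷ α) ‼ zero  = n
(n ∷ α) ‼ suc j = α ‼ j

-- The sums of the monomials of e_k that are divisible by x_j, respectively prime to x_j.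
u h : ℕ → ℕ → Series
u k j α = + (α ‼ j) ℤ.* e k α
h k j   = e k ⊞ ⊟ u k j

e-0-suc : ∀ n α → e 0 (suc n ∷ α) ≡ 0ℤ
e-0-suc n α = cong (λ b → if b then 1ℤ else 0ℤ) (∧-zeroʳ _)

u-zero : ∀ j → u 0 j ≈ 𝟘
u-zero j       []          = refl
u-zero zero    (zero ∷ α)  = ℤₚ.*-zeroˡ (e 0 (0 ∷ α))
u-zero zero    (suc n ∷ α) = trans (cong (ℤ._*_ (+ suc n)) (e-0-suc n α)) (ℤₚ.*-zeroʳ (+ suc n))
u-zero (suc j) (zero ∷ α)  = u-zero j α
u-zero (suc j) (suc n ∷ α) = trans (cong (ℤ._*_ (+ (α ‼ j))) (e-0-suc n α)) (ℤₚ.*-zeroʳ (+ (α ‼ j)))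

u-suc-raise : ∀ k j → u (suc k) j ≈ raise j (h k j)
u-suc-raise k j       []                = ℤₚ.*-zeroˡ (e (suc k) [])
u-suc-raise k zero    (zero ∷ α)        = ℤₚ.*-zeroˡ (e (suc k) (0 ∷ α))
u-suc-raise k zero    (1 ∷ α)           = trans (ℤₚ.*-identityˡ (e k α))
  (sym (trans (cong (λ z → e k α ℤ.+ ℤ.- z) (ℤₚ.*-zeroˡ (e k α))) (ℤₚ.+-identityʳ (e k α))))
-- The decisive case: h vanishes where x_j has exponent 1, so multiplying it by x_j creates no
-- square.
u-suc-raise k zero    (2 ∷ α)           = sym (trans
  (cong (λ z → e k (1 ∷ α) ℤ.+ ℤ.- z) (ℤₚ.*-identityˡ (e k (1 ∷ α)))) (ℤₚ.+-inverseʳ (e k (1 ∷ α))))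
u-suc-raise k zero    (suc (suc (suc n)) ∷ α) = trans (ℤₚ.*-zeroʳ (+ (3 ℕ.+ n)))
  (sym (cong (λ z → 0ℤ ℤ.+ ℤ.- z) (ℤₚ.*-zeroʳ (+ (2 ℕ.+ n)))))
u-suc-raise k (suc j) (zero ∷ α)        = u-suc-raise k j α
-- An exponent 1 at an earlier variable lowers the degree of e by one, which e_0 does not permit;
-- hence a separate case.
u-suc-raise zero (suc j) (suc zero ∷ α) = trans (u-zero j α) (sym (trans
  (raise-cong j (λ β → trans (cong (λ z → z ℤ.+ ℤ.- (+ (β ‼ j) ℤ.* z)) (e-0-suc 0 β))
    (cong (λ z → 0ℤ ℤ.+ ℤ.- z) (ℤₚ.*-zeroʳ (+ (β ‼ j))))) α) (raise-𝟘 j α)))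
u-suc-raise (suc k) (suc j) (suc zero ∷ α) = u-suc-raise k j α
u-suc-raise k (suc j) (suc (suc n) ∷ α) = trans (ℤₚ.*-zeroʳ (+ (α ‼ j))) (sym (trans
  (raise-cong j (λ β → cong (λ z → 0ℤ ℤ.+ ℤ.- z) (ℤₚ.*-zeroʳ (+ (β ‼ j)))) α) (raise-𝟘 j α)))

u-suc : ∀ k j → u (suc k) j ≈ var j · h k j
u-suc k j α = trans (u-suc-raise k j α) (sym (var-· j (h k j) α))

ι : ℕ → Series
ι zero    = 𝟘
ι (suc n) = 𝟙 ⊞ ι n

ι-· : ∀ n f α → (ι n · f) α ≡ + n ℤ.* f α
ι-· zero    f α = trans (·-zeroˡ f α) (sym (ℤₚ.*-zeroˡ (f α)))
ι-· (suc n) f α = trans (·-distribʳ f 𝟙 (ι n) α) (trans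
  (cong₂ ℤ._+_ (·-identityˡ f α) (ι-· n f α)) (sym (ℤₚ.suc-* (+ n) (f α))))

sum-‼ : ∀ α → ∑ ℤ._+_ 0ℤ (length α) (λ j → + (α ‼ j)) ≡ + sum α
sum-‼ []      = refl
sum-‼ (n ∷ α) = trans (ℤΣ.∑-head (length α) _) (cong (ℤ._+_ (+ n)) (sum-‼ α))

sum-e : ∀ k α → + sum α ℤ.* e k α ≡ + k ℤ.* e k α
sum-e k α = go (all? (ℕ._≤? 1) α) (sum α ℕ.≟ k)
  where
  go : ∀ {P : Set} (P? : Dec P) {m n} (m≟n : Dec (m ≡ n)) → let c = if does (P? ×-dec m≟n) then 1ℤ else 0ℤ in
    + m ℤ.* c ≡ + n ℤ.* c
  go P?      {m} {n} (yes refl) = refl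
  go (yes _) {m} {n} (no _)     = trans (ℤₚ.*-zeroʳ (+ m)) (sym (ℤₚ.*-zeroʳ (+ n)))
  go (no _)  {m} {n} (no _)     = trans (ℤₚ.*-zeroʳ (+ m)) (sym (ℤₚ.*-zeroʳ (+ n)))

-- u k j is e_k weighted by the exponent of x_j, so summing over j weights by the total degree,
-- which is k on the support of e_k. The length r ensures that every exponent is counted.
euler : ∀ r k → ∑ _⊞_ 𝟘 r (u k) ≈[ r ] ι k · e k
euler r k α refl = begin
  ∑ _⊞_ 𝟘 (length α) (u k) α                              ≡⟨ ∑-coeff (length α) (u k) α ⟩
  ∑ ℤ._+_ 0ℤ (length α) (λ j → + (α ‼ j) ℤ.* e k α)        ≡⟨ ℤΣ.∑-*ʳ (length α) _ (e k α) ⟩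
  ∑ ℤ._+_ 0ℤ (length α) (λ j → + (α ‼ j)) ℤ.* e k α        ≡⟨ cong (ℤ._* e k α) (sum-‼ α) ⟩
  + sum α ℤ.* e k α                                        ≡⟨ sum-e k α ⟩
  + k ℤ.* e k α                                            ≡⟨ ι-· k (e k) α ⟨
  (ι k · e k) α                                            ∎
  where open ≡.≡-Reasoning

-- e-positive series and families

-- The coefficient of tⁿ in 1 / (1 − ∑ (k − 1) e_k tᵏ), correct if the fuel is at least n.
w-fuel : ℕ → ℕ → Series
w-fuel f       zero    = 𝟙
w-fuel zero    (suc n) = 𝟘
w-fuel (suc f) (suc n) = conv _⊞_ n (λ a b → w-fuel f a · (ι b · e (suc b)))

w : ℕ → Series
w n = w-fuel n n

w-fuel-irrelevant : ∀ r {f f′} n → n ≤ f → n ≤ f′ → w-fuel f n ≈[ r ] w-fuel f′ n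
w-fuel-irrelevant r zero    _         _          = CommutativeRing.refl (seriesRing r) {𝟙}
w-fuel-irrelevant r {suc f} {suc f′} (suc n) (s≤s n≤f) (s≤s n≤f′) = RingSums.conv-cong (seriesRing r) n
  λ a b a+b≡n → CommutativeRing.*-congʳ (seriesRing r) {ι b · e (suc b)} {w-fuel f a} {w-fuel f′ a}
    (w-fuel-irrelevant r a (ℕₚ.≤-trans (a≤n a b a+b≡n) n≤f) (ℕₚ.≤-trans (a≤n a b a+b≡n) n≤f′))
  where
  a≤n : ∀ a b → a ℕ.+ b ≡ n → a ≤ n
  a≤n a b refl = ℕₚ.m≤m+n a b

w-suc : ∀ r n → w (suc n) ≈[ r ] conv _⊞_ n (λ a b → w a · (ι b · e (suc b)))
w-suc r n = RingSums.conv-cong (seriesRing r) n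
  λ { a b refl → CommutativeRing.*-congʳ (seriesRing r) {ι b · e (suc b)} {w-fuel n a} {w a}
    (w-fuel-irrelevant r a (ℕₚ.m≤m+n a b) ℕₚ.≤-refl) }

h+u≈e : ∀ k j → h k j ⊞ u k j ≈ e k
h+u≈e k j α = trans (ℤₚ.+-assoc (e k α) (ℤ.- u k j α) (u k j α))
  (trans (cong (ℤ._+_ (e k α)) (ℤₚ.+-inverseˡ (u k j α))) (ℤₚ.+-identityʳ (e k α)))

e-0≈𝟙 : ∀ α → e 0 α ≡ 𝟙 α
e-0≈𝟙 []          = refl
e-0≈𝟙 (zero ∷ α)  = e-0≈𝟙 α

e-0≈𝟙 (suc n ∷ α) = e-0-suc n α

h-zero : ∀ j → h 0 j ≈ 𝟙
h-zero j α = trans (cong (λ z → e 0 α ℤ.+ ℤ.- z) (u-zero j α)) (trans (ℤₚ.+-identityʳ _) (e-0≈𝟙 α))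

module Cycle (r : ℕ) = Attach (seriesRing r) ι (λ _ _ → refl) (λ _ _ _ → refl)
  r var e h u (λ k j α _ → h+u≈e k j α) (λ j α _ → h-zero j α) (λ j α _ → u-zero j α)
  (λ k j α _ → u-suc k j α) (euler r) w (λ _ _ → refl) (w-suc r)

-- Derivations of explicit series, not closed under equality: each yields a witness valid for every
-- number of variables. The index is the degree, needed later to arrive at partitions of n.
data EPos : ℕ → Series → Set where
  𝟘ᵖ   : ∀ {n} → EPos n 𝟘
  𝟙ᵖ   : EPos 0 𝟙
  eᵖ   : ∀ k → EPos k (e k)
  _+ᵖ_ : ∀ {n f g} → EPos n f → EPos n g → EPos n (f ⊞ g)
  _*ᵖ_ : ∀ {m n f g} → EPos m f → EPos n g → EPos (m ℕ.+ n) (f · g)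

EPos-ι : ∀ n → EPos 0 (ι n)
EPos-ι zero    = 𝟘ᵖ
EPos-ι (suc n) = 𝟙ᵖ +ᵖ EPos-ι n

EPos-conv : ∀ {N} n {G : ℕ → ℕ → Series} → (∀ i j → i ℕ.+ j ≡ n → EPos N (G i j)) →
  EPos N (conv _⊞_ n G)
EPos-conv zero    p = p 0 0 refl
EPos-conv (suc n) p = p 0 (suc n) refl +ᵖ EPos-conv n λ i j eq → p (suc i) j (cong suc eq)

EPos-w-fuel : ∀ f n → EPos n (w-fuel f n)
EPos-w-fuel f       zero    = 𝟙ᵖ
EPos-w-fuel zero    (suc n) = 𝟘ᵖ
EPos-w-fuel (suc f) (suc n) = EPos-conv n λ { a b refl →
  subst (λ m → EPos m (w-fuel f a · (ι b · e (suc b)))) (ℕₚ.+-suc a b)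
    (EPos-w-fuel f a *ᵖ (EPos-ι b *ᵖ eᵖ (suc b))) }

-- Combinations of the families u k with e-positive coefficients; the index is the total degree.
data VPos : ℕ → (ℕ → Series) → Set where
  𝟘ᵛ   : ∀ {n} → VPos n (λ _ → 𝟘)
  uᵛ   : ∀ k → VPos k (u k)
  _+ᵛ_ : ∀ {n F G} → VPos n F → VPos n G → VPos n (λ c → F c ⊞ G c)
  _*ᵛ_ : ∀ {m n f F} → EPos m f → VPos n F → VPos (m ℕ.+ n) (λ c → f · F c)

VPos-conv : ∀ {N} n {G : ℕ → ℕ → ℕ → Series} → (∀ i j → i ℕ.+ j ≡ n → VPos N (λ c → G c i j)) →
  VPos N (λ c → conv _⊞_ n (G c))
VPos-conv zero    p = p 0 0 refl
VPos-conv (suc n) p = p 0 (suc n) refl +ᵛ VPos-conv n λ i j eq → p (suc i) j (cong suc eq)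

VPos-∑ : ∀ {N} n {G : ℕ → ℕ → Series} → (∀ i → i < n → VPos N (λ c → G c i)) →
  VPos N (λ c → ∑ _⊞_ 𝟘 n (G c))
VPos-∑ zero    p = 𝟘ᵛ
VPos-∑ (suc n) p = VPos-∑ n (λ i i<n → p i (ℕₚ.m<n⇒m<1+n i<n)) +ᵛ p n ℕₚ.≤-refl

-- The argument 0 is arbitrary: `low` unfolds to a term without r, so this is also the `low` of
-- every other `Cycle r`. The same holds for `high`.
VPos-low : ∀ N k p → p ≤ N → VPos N (λ j → Cycle.low 0 j N k p)
VPos-low N k p p≤N = VPos-∑ p λ l l<p →
  subst (λ m → VPos m (λ j → ι (k ∸ suc l) · (e (N ∸ suc l) · u (suc l) j)))
    (ℕₚ.m∸n+n≡m (ℕₚ.<-≤-trans l<p p≤N)) (EPos-ι (k ∸ suc l) *ᵛ (eᵖ (N ∸ suc l) *ᵛ uᵛ (suc l)))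

VPos-high : ∀ N n p → p ≤ N → VPos N (λ j → Cycle.high 0 j N n p)
VPos-high N n p p≤N = VPos-∑ p λ i i<p →
  subst (λ m → VPos m (λ j → ι (n ∸ i) · (e i · u (N ∸ i) j)))
    (ℕₚ.m+[n∸m]≡n (ℕₚ.<⇒≤ (ℕₚ.<-≤-trans i<p p≤N))) (EPos-ι (n ∸ i) *ᵛ (eᵖ i *ᵛ uᵛ (N ∸ i)))

-- F′ is chosen before r. Attaching is linear over e-positive coefficients, so the expansion of V is
-- needed only in the case of u k.
VPos-attached : ∀ {N F} → VPos N F → ∀ n → ∃[ F′ ] (VPos (N ℕ.+ suc n) F′ ×
  (∀ r j → j < r → Cycle.attached r F n j ≈[ r ] F′ j))
VPos-attached 𝟘ᵛ n = _ , 𝟘ᵛ , λ r j _ → Cycle.attached-0 r n j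
VPos-attached (uᵛ k) n = _ , VPos-conv n (λ { a b refl →
    subst (λ m → VPos m (λ j → w a · (Cycle.low 0 j (k ℕ.+ suc b) k (k ⊓ suc b) ⊞ Cycle.high 0 j (k ℕ.+ suc b) (suc b) (k ⊓ suc b))))
      (degree a b) (EPos-w-fuel a a *ᵛ (VPos-low (k ℕ.+ suc b) k (k ⊓ suc b) (p≤N b) +ᵛ VPos-high (k ℕ.+ suc b) (suc b) (k ⊓ suc b) (p≤N b))) }) ,
  λ r j j<r → Cycle.attached-u r k n j j<r
  where
  p≤N : ∀ b → k ⊓ suc b ≤ k ℕ.+ suc b
  p≤N b = ℕₚ.≤-trans (ℕₚ.m⊓n≤m k (suc b)) (ℕₚ.m≤m+n k (suc b))
  degree : ∀ a b → a ℕ.+ (k ℕ.+ suc b) ≡ k ℕ.+ suc (a ℕ.+ b)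
  degree a b = trans (sym (ℕₚ.+-assoc a k (suc b))) (trans (cong (ℕ._+ suc b) (ℕₚ.+-comm a k))
    (trans (ℕₚ.+-assoc k a (suc b)) (cong (k ℕ.+_) (ℕₚ.+-suc a b))))
VPos-attached {F = F} (_+ᵛ_ {F = A} {B} p q) n with VPos-attached p n | VPos-attached q n
... | A′ , p′ , A≈ | B′ , q′ , B≈ = _ , p′ +ᵛ q′ , λ r j j<r →
  CommutativeRing.trans (seriesRing r) {Cycle.attached r F n j}
    {Cycle.attached r A n j ⊞ Cycle.attached r B n j} {A′ j ⊞ B′ j} (Cycle.attached-+ r A B n j)
    (λ α eq → cong₂ ℤ._+_ (A≈ r j j<r α eq) (B≈ r j j<r α eq))
VPos-attached {F = F} (_*ᵛ_ {m} {N} {f} {A} p q) n with VPos-attached q n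
... | A′ , q′ , A≈ = _ ,
  subst (λ k → VPos k (λ c → f · A′ c)) (sym (ℕₚ.+-assoc m N (suc n))) (p *ᵛ q′) , λ r j j<r →
  CommutativeRing.trans (seriesRing r) {Cycle.attached r F n j} {f · Cycle.attached r A n j} {f · A′ j}
    (Cycle.attached-* r f A n j) (CommutativeRing.*-congˡ (seriesRing r) {f} {Cycle.attached r A n j} {A′ j} (A≈ r j j<r))

EPos-∑ : ∀ {n F} → VPos n F → ∃[ f ] (EPos n f × (∀ r → ∑ _⊞_ 𝟘 r F ≈[ r ] f))
EPos-∑ 𝟘ᵛ = _ , 𝟘ᵖ , λ r → RingSums.∑-zero (seriesRing r) r (λ _ _ _ _ → refl)
EPos-∑ (uᵛ k) = _ , EPos-ι k *ᵖ eᵖ k , λ r → euler r k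
EPos-∑ (_+ᵛ_ {F = A} {B} p q) with EPos-∑ p | EPos-∑ q
... | a , p′ , A≈ | b , q′ , B≈ = _ , p′ +ᵖ q′ , λ r α eq →
  trans (RingSums.∑-+ (seriesRing r) r A B α eq) (cong₂ ℤ._+_ (A≈ r α eq) (B≈ r α eq))
EPos-∑ (_*ᵛ_ {f = f} {A} p q) with EPos-∑ q
... | a , q′ , A≈ = _ , p *ᵖ q′ , λ r α eq →
  trans (RingSums.∑-*ˡ (seriesRing r) r f A α eq)
    (CommutativeRing.*-congˡ (seriesRing r) {f} {∑ _⊞_ 𝟘 r A} {a} (A≈ r) α eq)

-- Expansion over partitions

ind : ∀ {P : Set} → Dec P → ℤ
ind P? = if does P? then 1ℤ else 0ℤ

sumℤ-map-+ : ∀ {A : Set} (f g : A → ℤ) xs →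
  sumℤ (map (λ x → f x ℤ.+ g x) xs) ≡ sumℤ (map f xs) ℤ.+ sumℤ (map g xs)
sumℤ-map-+ f g []       = refl
sumℤ-map-+ f g (x ∷ xs) = trans (cong (ℤ._+_ (f x ℤ.+ g x)) (sumℤ-map-+ f g xs))
  (ℤΣ.interchange (f x) (g x) (sumℤ (map f xs)) (sumℤ (map g xs)))

sumℤ-map-zero : ∀ {A : Set} {f : A → ℤ} xs → (∀ {x} → x ∈ xs → f x ≡ 0ℤ) → sumℤ (map f xs) ≡ 0ℤ
sumℤ-map-zero []       eq = refl
sumℤ-map-zero (x ∷ xs) eq = cong₂ ℤ._+_ (eq (here refl)) (sumℤ-map-zero xs (eq ∘ there))

sumℤ-· : ∀ {A : Set} (F : A → Series) g xs →
  (λ α → sumℤ (map (λ x → F x α) xs)) · g ≈ λ α → sumℤ (map (λ x → (F x · g) α) xs)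
sumℤ-· F g []       α = ·-zeroˡ g α
sumℤ-· F g (x ∷ xs) α = trans (·-distribʳ g (F x) _ α) (cong (ℤ._+_ ((F x · g) α)) (sumℤ-· F g xs α))

·-sumℤ : ∀ {A : Set} f (G : A → Series) xs →
  f · (λ α → sumℤ (map (λ x → G x α) xs)) ≈ λ α → sumℤ (map (λ x → (f · G x) α) xs)
·-sumℤ f G xs α = trans (·-comm f _ α) (trans (sumℤ-· G f xs α)
  (sumℤ-map-cong xs λ x → ·-comm (G x) f α))

eₗ-++ : ∀ p q → eₗ (p ++ q) ≈ eₗ p · eₗ q
eₗ-++ []      q α = sym (·-identityˡ (eₗ q) α)
eₗ-++ (k ∷ p) q α = trans (·-congˡ (e k) (eₗ-++ p q) α) (sym (·-assoc (e k) (eₗ p) (eₗ q) α))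

eₗ-↭ : ∀ {p q} → p ↭ q → eₗ p ≈ eₗ q
eₗ-↭ ↭-refl        α = refl
eₗ-↭ (prep k p↭q) α = ·-congˡ (e k) (eₗ-↭ p↭q) α
eₗ-↭ (swap {p} {q} k l p↭q) α = begin
  (e k · (e l · eₗ p)) α   ≡⟨ ·-assoc (e k) (e l) (eₗ p) α ⟨
  (e k · e l · eₗ p) α     ≡⟨ ·-congʳ (eₗ p) (·-comm (e k) (e l)) α ⟩
  (e l · e k · eₗ p) α     ≡⟨ ·-assoc (e l) (e k) (eₗ p) α ⟩
  (e l · (e k · eₗ p)) α   ≡⟨ ·-congˡ (e l) (·-congˡ (e k) (eₗ-↭ p↭q)) α ⟩
  (e l · (e k · eₗ q)) α   ∎
  where open ≡.≡-Reasoning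
eₗ-↭ (↭-trans p↭q q↭r) α = trans (eₗ-↭ p↭q α) (eₗ-↭ q↭r α)

dropZeros : List ℕ → List ℕ
dropZeros []          = []
dropZeros (zero ∷ p)  = dropZeros p
dropZeros (suc k ∷ p) = suc k ∷ dropZeros p

eₗ-dropZeros : ∀ p → eₗ (dropZeros p) ≈ eₗ p
eₗ-dropZeros []          α = refl
eₗ-dropZeros (zero ∷ p)  α = trans (eₗ-dropZeros p α) (sym
  (trans (·-congʳ (eₗ p) e-0≈𝟙 α) (·-identityˡ (eₗ p) α)))
eₗ-dropZeros (suc k ∷ p) α = ·-congˡ (e (suc k)) (eₗ-dropZeros p) α

sum-dropZeros : ∀ p → sum (dropZeros p) ≡ sum p
sum-dropZeros []          = refl
sum-dropZeros (zero ∷ p)  = sum-dropZeros p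
sum-dropZeros (suc k ∷ p) = cong (suc k ℕ.+_) (sum-dropZeros p)

dropZeros-positive : ∀ p → All (1 ≤_) (dropZeros p)
dropZeros-positive []          = []
dropZeros-positive (zero ∷ p)  = dropZeros-positive p
dropZeros-positive (suc k ∷ p) = s≤s z≤n ∷ dropZeros-positive p

module Descending = Sort (Flip.decTotalOrder ℕₚ.≤-decTotalOrder)

-- Multiplying out a derivation gives unsorted indices, possibly with factors e_0 = 1.
toPartition : List ℕ → List ℕ
toPartition p = Descending.sort (dropZeros p)

eₗ-toPartition : ∀ p → eₗ (toPartition p) ≈ eₗ p
eₗ-toPartition p α = trans (eₗ-↭ (Descending.sort-↭ (dropZeros p)) α) (eₗ-dropZeros p α)

toPartition-isPartition : ∀ p → IsPartition (sum p) (toPartition p)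
toPartition-isPartition p = Descending.sort-↗ (dropZeros p)
  , All-resp-↭ (↭-sym (Descending.sort-↭ (dropZeros p))) (dropZeros-positive p)
  , trans (sum-↭ (Descending.sort-↭ (dropZeros p))) (sum-dropZeros p)

parts≤sum : ∀ p → All (_≤ sum p) p
parts≤sum []      = []
parts≤sum (k ∷ p) = ℕₚ.m≤m+n k (sum p) ∷ All.map (λ l≤ → ℕₚ.≤-trans l≤ (ℕₚ.m≤n+m (sum p) k)) (parts≤sum p)

length≤sum : ∀ {p} → All (1 ≤_) p → length p ≤ sum p
length≤sum []         = z≤n
length≤sum (1≤k ∷ ps) = ℕₚ.+-mono-≤ 1≤k (length≤sum ps)

∈-words : ∀ {A : Set} {xs : List A} {p} → All (_∈ xs) p → p ∈ map toList (words xs (length p))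
∈-words {xs = xs} {p} p∈ = subst (_∈ map toList (words xs (length p))) (Vecₚ.toList∘fromList p)
  (∈-map⁺ toList (go p∈))
  where
  go : ∀ {p} → All (_∈ xs) p → fromList p ∈ words xs (length p)
  go []         = here refl
  go (k∈ ∷ p∈) = ∈-cartesianProductWith⁺ _∷_ k∈ (go p∈)

∈-partitions : ∀ {n p} → IsPartition n p → p ∈ partitions n
∈-partitions {n} {p} isP@(_ , pos , refl) = ∈-filter⁺ (isPartition? n)
  (∈-concatMap⁺ (λ l → map toList (words (upTo (suc n)) l))
    (lose (∈-upTo⁺ (s≤s (length≤sum pos))) (∈-words (All.map (∈-upTo⁺ ∘ s≤s) (parts≤sum p))))) isP

words-unique : ∀ {A : Set} {xs : List A} → Unique xs → ∀ n → Unique (words xs n)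
words-unique uxs zero    = [] ∷ []
words-unique uxs (suc n) = Uniqueₚ.cartesianProductWith⁺ _∷_ Vecₚ.∷-injective uxs (words-unique uxs n)

toList-injective : ∀ {A : Set} {n} {v w : Vec A n} → toList v ≡ toList w → v ≡ w
toList-injective {v = []}    {[]}    eq = refl
toList-injective {v = _ ∷ _} {_ ∷ _} eq with ∷-injective eq
... | refl , eq′ = cong (_ ∷_) (toList-injective eq′)

-- Blocks of different word lengths are disjoint, and words within a block are distinct. Without
-- repetitions, `eCombination` counts each e_λ once.
partitions-unique : ∀ n → Unique (partitions n)
partitions-unique n = Uniqueₚ.filter⁺ (isPartition? n) {concatMap block (upTo (suc n))}
  (Uniqueₚ.concat⁺ {xss = map block (upTo (suc n))}
    (Allₚ.map⁺ (All.universal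
      (λ l → Uniqueₚ.map⁺ toList-injective (words-unique (Uniqueₚ.upTo⁺ (suc n)) l)) (upTo (suc n))))
    (AllPairsₚ.map⁺ (AllPairsₚ.applyUpTo⁺₁ id (suc n) λ i<j _ (p∈ , p∈′) →
      ℕₚ.<⇒≢ i<j (trans (sym (lengthOf p∈)) (lengthOf p∈′)))))
  where
  block : ℕ → List (List ℕ)
  block l = map toList (words (upTo (suc n)) l)
  lengthOf : ∀ {l p} → p ∈ block l → length p ≡ l
  lengthOf p∈ with ∈-map⁻ toList p∈
  ... | v , _ , refl = Vecₚ.length-toList v

infix 4 _≟ₗ_
_≟ₗ_ : (p q : List ℕ) → Dec (p ≡ q)
_≟ₗ_ = ≡-dec ℕ._≟_

ind-≢ : ∀ {P : Set} (P? : Dec P) z → ¬ P → ind P? ℤ.* z ≡ 0ℤ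
ind-≢ (yes p) z ¬p = ⊥-elim (¬p p)
ind-≢ (no _)  z ¬p = ℤₚ.*-zeroˡ z

ind-yes : ∀ {P : Set} (P? : Dec P) z → P → ind P? ℤ.* z ≡ z
ind-yes (yes _) z p = ℤₚ.*-identityˡ z
ind-yes (no ¬p) z p = ⊥-elim (¬p p)

sumℤ-ind : ∀ {q} (f : List ℕ → ℤ) ps → Unique ps → q ∈ ps →
  sumℤ (map (λ p → ind (q ≟ₗ p) ℤ.* f p) ps) ≡ f q
sumℤ-ind {q} f (.q ∷ ps) (q∉ ∷ _) (here refl) = trans
  (cong₂ ℤ._+_ (ind-yes (q ≟ₗ q) (f q) refl) (sumℤ-map-zero ps λ {p} p∈ →
    ind-≢ (q ≟ₗ p) (f p) λ { refl → All.lookup q∉ p∈ refl })) (ℤₚ.+-identityʳ (f q))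
sumℤ-ind {q} f (p ∷ ps) (p∉ ∷ ups) (there q∈) = trans
  (cong₂ ℤ._+_ (ind-≢ (q ≟ₗ p) (f p) λ { refl → All.lookup p∉ q∈ refl }) (sumℤ-ind f ps ups q∈))
  (ℤₚ.+-identityˡ (f q))

eSum : List (List ℕ) → Series
eSum ps α = sumℤ (map (λ p → eₗ p α) ps)

EPos⇒eSum : ∀ {n f} → EPos n f → ∃[ ps ] (All (λ p → sum p ≡ n) ps × f ≈ eSum ps)
EPos⇒eSum 𝟘ᵖ     = [] , [] , λ _ → refl
EPos⇒eSum 𝟙ᵖ     = [ [] ] , refl ∷ [] , λ α → sym (ℤₚ.+-identityʳ (𝟙 α))
EPos⇒eSum (eᵖ k) = [ [ k ] ] , ℕₚ.+-identityʳ k ∷ [] , λ α → sym (trans (ℤₚ.+-identityʳ _)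
  (trans (·-comm (e k) 𝟙 α) (·-identityˡ (e k) α)))
EPos⇒eSum (p +ᵖ q) with EPos⇒eSum p | EPos⇒eSum q
... | ps , degs , f≈ | qs , degs′ , g≈ = ps ++ qs , Allₚ.++⁺ degs degs′ , λ α → trans
  (cong₂ ℤ._+_ (f≈ α) (g≈ α)) (trans (sym (sumℤ-++ (map (λ p → eₗ p α) ps) _))
  (cong sumℤ (sym (map-++ (λ p → eₗ p α) ps qs))))
EPos⇒eSum (_*ᵖ_ {m} {n} {f} {g} p q) with EPos⇒eSum p | EPos⇒eSum q
... | ps , degs , f≈ | qs , degs′ , g≈ = cartesianProductWith _++_ ps qs
  , Allₚ.cartesianProductWith⁺ (≡.setoid _) (≡.setoid _) _++_ ps qs
      (λ {p} {q} p∈ q∈ → trans (sum-++ p q) (cong₂ ℕ._+_ (All.lookup degs p∈) (All.lookup degs′ q∈)))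
  , λ α → begin
    (f · g) α
      ≡⟨ trans (·-congʳ g f≈ α) (·-congˡ (eSum ps) g≈ α) ⟩
    (eSum ps · eSum qs) α
      ≡⟨ sumℤ-· eₗ (eSum qs) ps α ⟩
    sumℤ (map (λ p → (eₗ p · eSum qs) α) ps)
      ≡⟨ sumℤ-map-cong ps (λ p → trans (·-sumℤ (eₗ p) eₗ qs α)
           (sumℤ-map-cong qs λ q → sym (eₗ-++ p q α))) ⟩
    sumℤ (map (λ p → sumℤ (map (λ q → eₗ (p ++ q) α) qs)) ps)
      ≡⟨ sumℤ-cartesianProductWith (λ p → eₗ p α) _++_ ps qs ⟨
    eSum (cartesianProductWith _++_ ps qs) α ∎
  where open ≡.≡-Reasoning

-- A multiplicity: how many products in the list become q when sorted. This is why the coefficients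
-- are nonnegative.
coefficient : List (List ℕ) → List ℕ → ℤ
coefficient ps q = sumℤ (map (λ p → ind (toPartition p ≟ₗ q)) ps)

coefficient-nonneg : ∀ ps q → 0ℤ ℤ.≤ coefficient ps q
coefficient-nonneg []       q = ℤₚ.≤-refl
coefficient-nonneg (p ∷ ps) q = ℤₚ.+-mono-≤ (ind-nonneg (toPartition p ≟ₗ q)) (coefficient-nonneg ps q)
  where
  ind-nonneg : ∀ {P : Set} (P? : Dec P) → 0ℤ ℤ.≤ ind P?
  ind-nonneg (yes _) = +≤+ z≤n
  ind-nonneg (no _)  = +≤+ z≤n

eSum≈eCombination : ∀ n ps → All (λ p → sum p ≡ n) ps → eSum ps ≈ eCombination n (coefficient ps)
eSum≈eCombination n []       []            α = sym (sumℤ-map-zero (partitions n) λ {q} _ → ℤₚ.*-zeroˡ (eₗ q α))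
eSum≈eCombination n (p ∷ ps) (refl ∷ degs) α = sym (begin
  sumℤ (map (λ q → (ind (toPartition p ≟ₗ q) ℤ.+ coefficient ps q) ℤ.* eₗ q α) (partitions n))
    ≡⟨ sumℤ-map-cong (partitions n) (λ q → ℤₚ.*-distribʳ-+ (eₗ q α) (ind (toPartition p ≟ₗ q)) _) ⟩
  sumℤ (map (λ q → ind (toPartition p ≟ₗ q) ℤ.* eₗ q α ℤ.+ coefficient ps q ℤ.* eₗ q α) (partitions n))
    ≡⟨ sumℤ-map-+ _ _ (partitions n) ⟩
  sumℤ (map (λ q → ind (toPartition p ≟ₗ q) ℤ.* eₗ q α) (partitions n)) ℤ.+ eCombination n (coefficient ps) α
    ≡⟨ cong₂ ℤ._+_
         (trans (sumℤ-ind (λ q → eₗ q α) (partitions n) (partitions-unique n) (∈-partitions (toPartition-isPartition p)))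
           (eₗ-toPartition p α))
         (sym (eSum≈eCombination n ps degs α)) ⟩
  eₗ p α ℤ.+ eSum ps α ∎)
  where open ≡.≡-Reasoning

EPos⇒EPositive : ∀ G {f} → EPos (order G) f → X G ≈ f → EPositive G
EPos⇒EPositive G pos X≈ with EPos⇒eSum pos
... | ps , degs , f≈ = coefficient ps
  , (λ α → trans (X≈ α) (trans (f≈ α) (eSum≈eCombination (order G) ps degs α)))
  , All.universal (coefficient-nonneg ps) _

-- Colourings of cycle chains

when : ∀ {P : Set} → Dec P → Series → Series
when P? f = if does P? then f else 𝟘

when-⇔ : ∀ {P Q : Set} (P? : Dec P) (Q? : Dec Q) f → P ⇔ Q → when P? f ≡ when Q? f
when-⇔ P? Q? f P⇔Q = cong (λ b → if b then f else 𝟘) (does-⇔ P⇔Q P? Q?)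

-- Colourings are read as functions on ℕ, which spares casts between the vertex
-- types of a sum of graphs.
ProperOn : Graph → (ℕ → ℕ) → Set
ProperOn G f = All (λ (u , v) → f (toℕ u) ≢ f (toℕ v)) (edges G)

properOn? : ∀ G f → Dec (ProperOn G f)
properOn? G f = all? (λ (u , v) → ¬? (f (toℕ u) ℕ.≟ f (toℕ v))) (edges G)

weight : List ℕ → Series
weight []      = 𝟙
weight (c ∷ v) = var c · weight v

module _ (r : ℕ) where
  open CommutativeRing (seriesRing r) using () renaming
    (refl to ≈-refl; trans to ≈-trans)
  open RingSums (seriesRing r)

  ∑words : ℕ → (List ℕ → Series) → Series
  ∑words zero    φ = φ []
  ∑words (suc n) φ = ∑ _⊞_ 𝟘 r (λ c → ∑words n (λ v → φ (c ∷ v)))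

  ∑words-cong : ∀ n {φ ψ : List ℕ → Series} → (∀ v → φ v ≈[ r ] ψ v) → ∑words n φ ≈[ r ] ∑words n ψ
  ∑words-cong zero    eq = eq []
  ∑words-cong (suc n) eq = ∑-cong r λ c _ → ∑words-cong n λ v → eq (c ∷ v)

  ∑words-· : ∀ n f (φ : List ℕ → Series) → ∑words n (λ v → f · φ v) ≈[ r ] f · ∑words n φ
  ∑words-· zero    f φ = ≈-refl {f · φ []}
  ∑words-· (suc n) f φ = ≈-trans {∑words (suc n) (λ v → f · φ v)}
    {∑ _⊞_ 𝟘 r (λ c → f · ∑words n (λ v → φ (c ∷ v)))} {f · ∑words (suc n) φ}
    (∑-cong r λ c _ → ∑words-· n f (λ v → φ (c ∷ v)))
    (∑-*ˡ r f (λ c → ∑words n (λ v → φ (c ∷ v))))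

  ∑words-unless : ∀ n {P : Set} (P? : Dec P) (φ : List ℕ → Series) →
    ∑words n (λ v → unless P? (φ v)) ≈[ r ] unless P? (∑words n φ)
  ∑words-unless n       (no _)  φ = ≈-refl {∑words n φ}
  ∑words-unless zero    (yes _) φ = ≈-refl {𝟘}
  ∑words-unless (suc n) (yes p) φ = ∑-zero r λ c _ → ∑words-unless n (yes p) (λ v → φ (c ∷ v))

  when-·unless : ∀ {A B C : Set} (A? : Dec A) (B? : Dec B) (C? : Dec C) f m →
    when ((¬? A? ×-dec B?) ×-dec C?) (f · m) ≈[ r ] unless A? (f · when (B? ×-dec C?) m)
  when-·unless (yes _) B? C? f m = ≈-refl {𝟘}
  when-·unless (no _)  B? C? f m with does (B? ×-dec C?)
  ... | true  = ≈-refl {f · m}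
  ... | false = λ α _ → sym (trans (·-comm f 𝟘 α) (·-zeroˡ f α))

  when-unless : ∀ {A B : Set} (A? : Dec A) (B? : Dec B) m →
    when (yes tt ×-dec (¬? A? ×-dec B?)) m ≡ unless A? (when B? m)
  when-unless (yes _) B? m = refl
  when-unless (no _)  B? m = refl

  -- `l` counts the vertices after the first, which has colour c.
  pointed : ℕ → ∀ {P : (ℕ → ℕ) → Set} → (∀ f → Dec (P f)) → ℕ → Series
  pointed l P? c = ∑words l (λ v → when (P? ((c ∷ v) ‼_)) (weight (c ∷ v)))

-- The later vertex is written first, so that the test is literally the `d ≟ c` of the sums `∑≠` in
-- `Q`.
Path : ℕ → (ℕ → ℕ) → Set
Path zero    f = ⊤
Path (suc k) f = f 1 ≢ f 0 × Path k (f ∘ suc)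

path? : ∀ k f → Dec (Path k f)
path? zero    f = yes tt
path? (suc k) f = ¬? (f 1 ℕ.≟ f 0) ×-dec path? k (f ∘ suc)

module _ {P : (ℕ → ℕ) → Set} (P? : ∀ f → Dec (P f)) (l : ℕ) where

  -- Vertices 0 to k form the path, and vertex k is also the first vertex of the rest, subject to P.
  -- The first colour j is a parameter because it must survive while the path is consumed from the
  -- front.
  ClosedPathThen : ℕ → ℕ → (ℕ → ℕ) → Set
  ClosedPathThen k j f = Path k f × (f k ≢ j × P (λ i → f (k ℕ.+ i)))

  closedPathThen? : ∀ k j f → Dec (ClosedPathThen k j f)
  closedPathThen? k j f = path? k f ×-dec (¬? (f k ℕ.≟ j) ×-dec P? (λ i → f (k ℕ.+ i)))

  -- Removing the first vertex is one step of `Q`; at the end of the path the closing edge cuts the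
  -- colour j out of the weight of the rest.
  pointed-closedPath : ∀ r j k c →
    pointed r (k ℕ.+ l) (closedPathThen? k j) c
      ≈[ r ] Cycle.Q r (λ c → RingSums.unless (seriesRing r) (c ℕ.≟ j) (pointed r l P? c)) k c
  pointed-closedPath r j zero c = λ α eq → trans
    (∑words-cong r l (λ v α _ → cong (λ f → f α)
      (when-unless r (c ℕ.≟ j) (P? ((c ∷ v) ‼_)) (weight (c ∷ v)))) α eq)
    (∑words-unless r l (c ℕ.≟ j) (λ v → when (P? ((c ∷ v) ‼_)) (weight (c ∷ v))) α eq)
  pointed-closedPath r j (suc k) c = λ α eq → trans
    (RingSums.∑-cong (seriesRing r) r (λ d d<r → step d) α eq)
    (RingSums.∑≠-*ˡ (seriesRing r) r c (var c) (Cycle.Q r φ k) α eq)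
    where
    open RingSums (seriesRing r) using (unless; unless-cong)
    φ : ℕ → Series
    φ c = unless (c ℕ.≟ j) (pointed r l P? c)
    term : ℕ → List ℕ → Series
    term d v = when (closedPathThen? k j ((d ∷ v) ‼_)) (weight (d ∷ v))
    rest? : ∀ d v → Dec ((d ∷ v) ‼ k ≢ j × P (λ i → (d ∷ v) ‼ (k ℕ.+ i)))
    rest? d v = ¬? ((d ∷ v) ‼ k ℕ.≟ j) ×-dec P? (λ i → (d ∷ v) ‼ (k ℕ.+ i))
    step : ∀ d →
      ∑words r (k ℕ.+ l) (λ v → when (closedPathThen? (suc k) j ((c ∷ d ∷ v) ‼_)) (weight (c ∷ d ∷ v)))
        ≈[ r ] unless (d ℕ.≟ c) (var c · Cycle.Q r φ k d)
    step d α eq = begin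
      ∑words r (k ℕ.+ l) (λ v → when (closedPathThen? (suc k) j ((c ∷ d ∷ v) ‼_)) (weight (c ∷ d ∷ v))) α
        ≡⟨ ∑words-cong r (k ℕ.+ l) (λ v → when-·unless r (d ℕ.≟ c) (path? k ((d ∷ v) ‼_)) (rest? d v)
             (var c) (weight (d ∷ v))) α eq ⟩
      ∑words r (k ℕ.+ l) (λ v → unless (d ℕ.≟ c) (var c · term d v)) α
        ≡⟨ ∑words-unless r (k ℕ.+ l) (d ℕ.≟ c) (λ v → var c · term d v) α eq ⟩
      unless (d ℕ.≟ c) (∑words r (k ℕ.+ l) (λ v → var c · term d v)) α
        ≡⟨ unless-cong (d ℕ.≟ c) {∑words r (k ℕ.+ l) (λ v → var c · term d v)} {var c · Cycle.Q r φ k d}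
             (λ _ α eq → trans (∑words-· r (k ℕ.+ l) (var c) (term d) α eq)
               (CommutativeRing.*-congˡ (seriesRing r) {var c} {∑words r (k ℕ.+ l) (term d)} {Cycle.Q r φ k d}
                 (pointed-closedPath r j k d) α eq)) α eq ⟩
      unless (d ℕ.≟ c) (var c · Cycle.Q r φ k d) α ∎
      where open ≡.≡-Reasoning

pointed-⇔ : ∀ r l {P Q : (ℕ → ℕ) → Set} (P? : ∀ f → Dec (P f)) (Q? : ∀ f → Dec (Q f)) c →
  (∀ f → f 0 ≡ c → P f ⇔ Q f) → pointed r l P? c ≈[ r ] pointed r l Q? c
pointed-⇔ r l P? Q? c P⇔Q = ∑words-cong r l λ v α _ → cong (λ f → f α)
  (when-⇔ (P? _) (Q? _) (weight (c ∷ v)) (P⇔Q ((c ∷ v) ‼_) refl))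

Path⇔ : ∀ k f → (∀ (i : Fin k) → f (toℕ (inject₁ i)) ≢ f (suc (toℕ i))) ⇔ Path k f
Path⇔ zero    f = mk⇔ (λ _ → tt) (λ _ ())
Path⇔ (suc k) f = mk⇔
  (λ p → ≢-sym (p zero) , Equivalence.to (Path⇔ k (f ∘ suc)) (p ∘ suc))
  (λ { (p , ps) zero → ≢-sym p ; (p , ps) (suc i) → Equivalence.from (Path⇔ k (f ∘ suc)) ps i })

cycle⇔ : ∀ k p f → ProperOn (cycle (suc k) p) f ⇔ (Path k f × f k ≢ f 0)
cycle⇔ k p f = mk⇔ to from
  where
  to : ProperOn (cycle (suc k) p) f → Path k f × f k ≢ f 0
  to ps with Allₚ.++⁻ (map (λ i → inject₁ i , suc i) (allFin k)) ps
  ... | ps′ , (q ∷ []) = Equivalence.to (Path⇔ k f) (Allₚ.tabulate⁻ (Allₚ.map⁻ ps′))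
    , subst (λ i → f i ≢ f 0) (Finₚ.toℕ-fromℕ k) q
  from : Path k f × f k ≢ f 0 → ProperOn (cycle (suc k) p) f
  from (ps , q) = Allₚ.++⁺ (Allₚ.map⁺ (Allₚ.tabulate⁺ (Equivalence.from (Path⇔ k f) ps)))
    (subst (λ i → f i ≢ f 0) (sym (Finₚ.toℕ-fromℕ k)) q ∷ [])

⊕⇔ : ∀ G₁ G₂ f → ProperOn (G₁ ⊕ G₂) f ⇔ (ProperOn G₁ f × ProperOn G₂ (λ i → f (last G₁ ℕ.+ i)))
⊕⇔ G₁ G₂ f = mk⇔ to from
  where
  k = last G₁
  right-toℕ : ∀ v → toℕ (cast (ℕₚ.+-suc k (last G₂)) (k ↑ʳ v)) ≡ k ℕ.+ toℕ v
  right-toℕ v = trans (Finₚ.toℕ-cast _ (k ↑ʳ v)) (Finₚ.toℕ-↑ʳ k v)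
  left-≡ : ∀ u → f (toℕ (u ↑ˡ last G₂)) ≡ f (toℕ u)
  left-≡ u = cong f (Finₚ.toℕ-↑ˡ u (last G₂))
  right-≡ : ∀ v → f (toℕ (cast (ℕₚ.+-suc k (last G₂)) (k ↑ʳ v))) ≡ f (k ℕ.+ toℕ v)
  right-≡ v = cong f (right-toℕ v)
  to : ProperOn (G₁ ⊕ G₂) f → ProperOn G₁ f × ProperOn G₂ (λ i → f (k ℕ.+ i))
  to ps with Allₚ.++⁻ (map _ (edges G₁)) ps
  ... | ps₁ , ps₂ =
      All.map (λ {(u , v)} → subst id (cong₂ _≢_ (left-≡ u) (left-≡ v))) (Allₚ.map⁻ ps₁)
    , All.map (λ {(u , v)} → subst id (cong₂ _≢_ (right-≡ u) (right-≡ v))) (Allₚ.map⁻ ps₂)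
  from : ProperOn G₁ f × ProperOn G₂ (λ i → f (k ℕ.+ i)) → ProperOn (G₁ ⊕ G₂) f
  from (ps₁ , ps₂) = Allₚ.++⁺
    (Allₚ.map⁺ (All.map (λ {(u , v)} → subst id (sym (cong₂ _≢_ (left-≡ u) (left-≡ v)))) ps₁))
    (Allₚ.map⁺ (All.map (λ {(u , v)} → subst id (sym (cong₂ _≢_ (right-≡ u) (right-≡ v)))) ps₂))

pointedX : ℕ → Graph → ℕ → Series
pointedX r G c = pointed r (last G) (properOn? G) c

VPositive : Graph → Set
VPositive G = ∃[ F ] (VPos (order G) F × (∀ r c → c < r → pointedX r G c ≈[ r ] F c))

-- `N` and `Q` are fixed only up to an equation and an equivalence, so that a lone cycle and a sum
-- of graphs are both covered. The cycle has k + 2 vertices, of which k + 1 are new.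
attach-cycle : ∀ k l N → suc k ℕ.+ l ≡ N → ∀ {P Q : (ℕ → ℕ) → Set} (P? : ∀ f → Dec (P f)) (Q? : ∀ f → Dec (Q f)) →
  (∀ f → Q f ⇔ ClosedPathThen P? l (suc k) (f 0) f) →
  ∀ {n F} → VPos n F → (∀ r c → c < r → pointed r l P? c ≈[ r ] F c) →
  ∃[ F′ ] (VPos (n ℕ.+ suc k) F′ × (∀ r c → c < r → pointed r N Q? c ≈[ r ] F′ c))
attach-cycle k l _ refl P? Q? Q⇔ {n} {F} F-pos F≈ = let (F′ , F′-pos , F′≈) = VPos-attached F-pos k in F′ , F′-pos , λ r c c<r α eq → begin
  pointed r (suc k ℕ.+ l) Q? c α
    -- The closing edge refers to `f 0`, which `pointed` has fixed to c.
    ≡⟨ pointed-⇔ r (suc k ℕ.+ l) Q? (closedPathThen? P? l (suc k) c) c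
         (λ { f refl → Q⇔ f }) α eq ⟩
  pointed r (suc k ℕ.+ l) (closedPathThen? P? l (suc k) c) c α
    ≡⟨ pointed-closedPath P? l r c (suc k) c α eq ⟩
  Cycle.Q r (λ d → RingSums.unless (seriesRing r) (d ℕ.≟ c) (pointed r l P? d)) (suc k) c α
    ≡⟨ Cycle.Q-attached r (pointed r l P?) k c c<r α eq ⟩
  Cycle.attached r (pointed r l P?) k c α
    ≡⟨ Cycle.attached-cong r {pointed r l P?} {F} k c (F≈ r) α eq ⟩
  Cycle.attached r F k c α
    ≡⟨ F′≈ r c c<r α eq ⟩
  proj₁ (VPos-attached F-pos k) c α ∎
  where open ≡.≡-Reasoning

-- A lone cycle is treated as attached to a single vertex, whose family x_c = u 1 c starts the
-- induction.
point : Graph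
point = record { last = 0 ; edges = [] }

pointedX-point : ∀ r c → c < r → pointedX r point c ≈[ r ] u 1 c
pointedX-point r c _ = CommutativeRing.sym (seriesRing r) {u 1 c} {var c · 𝟙} λ α _ →
  trans (u-suc 0 c α) (·-congˡ (var c) (h-zero c) α)

VPositive-cycle : ∀ a p → VPositive (cycle a p)
VPositive-cycle (suc zero)    (s≤s ())
VPositive-cycle (suc (suc k)) p = attach-cycle k 0 (suc k) (ℕₚ.+-identityʳ (suc k)) (properOn? point) (properOn? (cycle (2 ℕ.+ k) p))
  (λ f → mk⇔ (λ q → let (ps , q′) = Equivalence.to (cycle⇔ (suc k) p f) q in ps , (q′ , []))
             (λ (ps , (q′ , _)) → Equivalence.from (cycle⇔ (suc k) p f) (ps , q′)))
  (uᵛ 1) pointedX-point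

VPositive-⊕ : ∀ a p {G} → VPositive G → VPositive (cycle a p ⊕ G)
VPositive-⊕ (suc zero)    (s≤s ()) _
VPositive-⊕ (suc (suc k)) p {G} (F , F-pos , F≈) =
  let (F′ , F′-pos , F′≈) = attach-cycle k (last G) _ refl (properOn? G)
        (properOn? (cycle (2 ℕ.+ k) p ⊕ G))
        (λ f → mk⇔ (λ q → let (q₁ , q₂) = Equivalence.to (⊕⇔ (cycle (2 ℕ.+ k) p) G f) q
                              (ps , q′) = Equivalence.to (cycle⇔ (suc k) p f) q₁ in ps , (q′ , q₂))
                   (λ (ps , (q′ , q₂)) → Equivalence.from (⊕⇔ (cycle (2 ℕ.+ k) p) G f)
                     (Equivalence.from (cycle⇔ (suc k) p f) (ps , q′) , q₂)))
        F-pos F≈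
  in F′ , subst (λ n → VPos (suc n) F′) (ℕₚ.+-comm (last G) (suc k)) F′-pos , F′≈

VPositive-chain : ∀ m .{{_ : NonZero m}} a a≥2 → VPositive (cycleChain m a a≥2)
VPositive-chain (suc zero)    a a≥2 = VPositive-cycle (a zero) (a≥2 zero)
VPositive-chain (suc (suc m)) a a≥2 =
  VPositive-⊕ (a zero) (a≥2 zero) (VPositive-chain (suc m) (a ∘ suc) (a≥2 ∘ suc))

-- Coefficients of the chromatic symmetric function

ind-⇔ : ∀ {P Q : Set} (P? : Dec P) (Q? : Dec Q) → P ⇔ Q → ind P? ≡ ind Q?
ind-⇔ P? Q? P⇔Q = cong (λ b → if b then 1ℤ else 0ℤ) (does-⇔ P⇔Q P? Q?)

bump : ℕ → List ℕ → List ℕ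
bump j       []      = []
bump zero    (n ∷ α) = suc n ∷ α
bump (suc j) (n ∷ α) = n ∷ bump j α

bump-injective : ∀ j {α β} → bump j α ≡ bump j β → α ≡ β
bump-injective j       {[]}    {[]}    eq = refl
bump-injective zero    {[]}    {_ ∷ _} ()
bump-injective (suc j) {[]}    {_ ∷ _} ()
bump-injective zero    {_ ∷ _} {[]}    ()
bump-injective (suc j) {_ ∷ _} {[]}    ()
bump-injective zero    {_ ∷ _} {_ ∷ _} eq with ∷-injective eq
... | refl , refl = refl
bump-injective (suc j) {_ ∷ _} {_ ∷ _} eq with ∷-injective eq
... | refl , eq′ = cong (_ ∷_) (bump-injective j eq′)

raise-bump : ∀ j f α → j < length α → raise j f (bump j α) ≡ f α
raise-bump zero    f (n ∷ α) _         = refl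
raise-bump (suc j) f (n ∷ α) (s≤s j<) = raise-bump j (f ∘ (n ∷_)) α j<

length-bump : ∀ j α → length (bump j α) ≡ length α
length-bump j       []      = refl
length-bump zero    (n ∷ α) = refl
length-bump (suc j) (n ∷ α) = cong suc (length-bump j α)

-- Whether x_j divides α, with `free` storing the two consequences used. Its bound on j is
-- essential, since `bump` is the identity out of range.
data Divisibility (j : ℕ) : List ℕ → Set where
  free    : ∀ {α} → (∀ f → raise j f α ≡ 0ℤ) → (∀ β → j < length β → bump j β ≢ α) → Divisibility j α
  divides : ∀ β → Divisibility j (bump j β)

divisibility : ∀ j α → Divisibility j α
divisibility j       []          = free (λ _ → refl) λ { (n ∷ β) _ → bump≢[] j n β }
  where
  bump≢[] : ∀ j n β → bump j (n ∷ β) ≢ []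
  bump≢[] zero    n β ()
  bump≢[] (suc j) n β ()
divisibility zero    (zero ∷ α)  = free (λ _ → refl) λ { (n ∷ β) _ () }
divisibility zero    (suc n ∷ α) = divides (n ∷ α)
divisibility (suc j) (n ∷ α) with divisibility j α
... | divides β   = divides (n ∷ β)
... | free r≡0 b≢ = free (λ f → r≡0 (f ∘ (n ∷_)))
  λ { (m ∷ β) (s≤s j<) eq → b≢ β j< (proj₂ (∷-injective eq)) }

count-yes : ∀ {P : ℕ → Set} (P? : ∀ i → Dec (P i)) {n x} (v : Vec ℕ n) → P x → count P? (x ∷ v) ≡ suc (count P? v)
count-yes P? {x = x} v p with P? x
... | yes _ = refl
... | no ¬p = ⊥-elim (¬p p)

count-no : ∀ {P : ℕ → Set} (P? : ∀ i → Dec (P i)) {n x} (v : Vec ℕ n) → ¬ P x → count P? (x ∷ v) ≡ count P? v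
count-no P? {x = x} v ¬p with P? x
... | yes p = ⊥-elim (¬p p)
... | no _  = refl

applyUpTo-cong : ∀ n {f g : ℕ → ℕ} → (∀ i → f i ≡ g i) → applyUpTo f n ≡ applyUpTo g n
applyUpTo-cong zero    eq = refl
applyUpTo-cong (suc n) eq = cong₂ _∷_ (eq 0) (applyUpTo-cong n (eq ∘ suc))

applyUpTo-bump : ∀ c r {f g : ℕ → ℕ} → c < r → f c ≡ suc (g c) → (∀ i → c ≢ i → f i ≡ g i) →
  applyUpTo f r ≡ bump c (applyUpTo g r)
applyUpTo-bump zero    (suc r) _         eq eqs =
  cong₂ _∷_ eq (applyUpTo-cong r λ i → eqs (suc i) λ ())
applyUpTo-bump (suc c) (suc r) (s≤s c<r) eq eqs =
  cong₂ _∷_ (eqs 0 λ ()) (applyUpTo-bump c r c<r eq λ i c≢i → eqs (suc i) (c≢i ∘ ℕₚ.suc-injective))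

monomial≡applyUpTo : ∀ {n} r (κ : Vec ℕ n) → monomial r κ ≡ applyUpTo (λ i → count (ℕ._≟ i) κ) r
monomial≡applyUpTo r κ = map-applyUpTo id (λ i → count (ℕ._≟ i) κ) r

length-monomial : ∀ {n} r (κ : Vec ℕ n) → length (monomial r κ) ≡ r
length-monomial r κ = trans (cong length (monomial≡applyUpTo r κ)) (length-applyUpTo _ r)

monomial-∷ : ∀ {n} r c (κ : Vec ℕ n) → c < r → monomial r (c ∷ κ) ≡ bump c (monomial r κ)
monomial-∷ r c κ c<r = trans (monomial≡applyUpTo r (c ∷ κ)) (trans
  (applyUpTo-bump c r c<r (count-yes (ℕ._≟ c) κ refl) (λ i → count-no (ℕ._≟ i) κ))
  (cong (bump c) (sym (monomial≡applyUpTo r κ))))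

monomial-[]⇔ : ∀ α → All (_≡ 0) α ⇔ monomial (length α) [] ≡ α
monomial-[]⇔ α = mk⇔
  (λ α≡0 → trans (monomial≡applyUpTo (length α) []) (to α≡0))
  (λ eq → from α (trans (sym (monomial≡applyUpTo (length α) [])) eq))
  where
  to : ∀ {α} → All (_≡ 0) α → applyUpTo (λ _ → 0) (length α) ≡ α
  to []           = refl
  to (refl ∷ α≡0) = cong (0 ∷_) (to α≡0)
  from : ∀ α → applyUpTo (λ _ → 0) (length α) ≡ α → All (_≡ 0) α
  from []      eq = []
  from (n ∷ α) eq with ∷-injective eq
  ... | refl , eq′ = refl ∷ from α eq′

-- Multiplying by x_c and colouring one more vertex c both increase the exponent at c. If x_c does
-- not divide α, both sides vanish.
weight-coeff : ∀ {n} r (κ : Vec ℕ n) → All (_< r) (toList κ) → ∀ α → length α ≡ r →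
  weight (toList κ) α ≡ ind (monomial r κ ≟ₗ α)
weight-coeff r []      []           α refl = ind-⇔ (all? (ℕ._≟ 0) α) (monomial r [] ≟ₗ α) (monomial-[]⇔ α)
weight-coeff r (c ∷ κ) (c<r ∷ κ<r) α eq = trans (var-· c (weight (toList κ)) α) (go (divisibility c α) eq)
  where
  go : ∀ {α} → Divisibility c α → length α ≡ r →
    raise c (weight (toList κ)) α ≡ ind (monomial r (c ∷ κ) ≟ₗ α)
  go {α} (free r≡0 b≢) eq = trans (r≡0 _) (sym (ind-no (monomial r (c ∷ κ) ≟ₗ α) λ m≡α →
    b≢ (monomial r κ) (subst (c <_) (sym (length-monomial r κ)) c<r) (trans (sym (monomial-∷ r c κ c<r)) m≡α)))
    where
    ind-no : ∀ {P : Set} (P? : Dec P) → ¬ P → ind P? ≡ 0ℤ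
    ind-no (yes p) ¬p = ⊥-elim (¬p p)
    ind-no (no _)  _  = refl
  go (divides β) eq = trans (raise-bump c _ β (subst (c <_) (sym |β|≡r) c<r))
    (trans (weight-coeff r κ κ<r β |β|≡r) (ind-⇔ (monomial r κ ≟ₗ β) (monomial r (c ∷ κ) ≟ₗ bump c β) (mk⇔
      (λ m≡β → trans (monomial-∷ r c κ c<r) (cong (bump c) m≡β))
      (λ m≡b → bump-injective c (trans (sym (monomial-∷ r c κ c<r)) m≡b)))))
    where
    |β|≡r : length β ≡ r
    |β|≡r = trans (sym (length-bump c β)) eq

sumℤ-words : ∀ r n (F : Vec ℕ n → ℤ) (φ : List ℕ → Series) α →
  (∀ κ → All (_< r) (toList κ) → F κ ≡ φ (toList κ) α) →
  sumℤ (map F (words (upTo r) n)) ≡ ∑words r n φ α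
sumℤ-words r zero    F φ α eq = trans (ℤₚ.+-identityʳ (F [])) (eq [] [])
sumℤ-words r (suc n) F φ α eq = begin
  sumℤ (map F (words (upTo r) (suc n)))
    ≡⟨ sumℤ-cartesianProductWith F _∷_ (upTo r) (words (upTo r) n) ⟩
  sumℤ (map (λ c → sumℤ (map (λ κ → F (c ∷ κ)) (words (upTo r) n))) (upTo r))
    ≡⟨ sumℤ-upTo r _ ⟩
  ∑ ℤ._+_ 0ℤ r (λ c → sumℤ (map (λ κ → F (c ∷ κ)) (words (upTo r) n)))
    ≡⟨ ℤΣ.∑-cong r (λ c c<r → sumℤ-words r n (λ κ → F (c ∷ κ)) (λ v → φ (c ∷ v)) α
         λ κ κ<r → eq (c ∷ κ) (c<r ∷ κ<r)) ⟩
  ∑ ℤ._+_ 0ℤ r (λ c → ∑words r n (λ v → φ (c ∷ v)) α)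
    ≡⟨ ∑-coeff r _ α ⟨
  ∑words r (suc n) φ α ∎
  where open ≡.≡-Reasoning

length-filter-ind : ∀ {A : Set} {P : A → Set} (P? : ∀ x → Dec (P x)) xs →
  + length (filter P? xs) ≡ sumℤ (map (λ x → ind (P? x)) xs)
length-filter-ind P? []       = refl
length-filter-ind P? (x ∷ xs) with does (P? x)
... | true  = cong (ℤ._+_ 1ℤ) (length-filter-ind P? xs)
... | false = trans (length-filter-ind P? xs) (sym (ℤₚ.+-identityˡ _))

lookup≡‼ : ∀ {n} (κ : Vec ℕ n) i → lookup κ i ≡ toList κ ‼ toℕ i
lookup≡‼ (c ∷ κ) zero    = refl
lookup≡‼ (c ∷ κ) (suc i) = lookup≡‼ κ i

proper⇔ : ∀ G κ → Proper G κ ⇔ ProperOn G (toList κ ‼_)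
proper⇔ G κ = mk⇔
  (All.map λ {(u , v)} → subst id (cong₂ _≢_ (lookup≡‼ κ u) (lookup≡‼ κ v)))
  (All.map λ {(u , v)} → subst id (sym (cong₂ _≢_ (lookup≡‼ κ u) (lookup≡‼ κ v))))

-- `order G` is `suc (last G)`, so the sum over words unfolds to a sum over the colour of the first
-- vertex.
X≡∑pointed : ∀ G α → X G α ≡ ∑ _⊞_ 𝟘 (length α) (pointedX (length α) G) α
X≡∑pointed G α = trans (length-filter-ind _ (words (upTo r) (order G)))
  (sumℤ-words r (order G) _ (λ v → when (properOn? G (v ‼_)) (weight v)) α λ κ κ<r →
    coeff (proper? G κ) (properOn? G (toList κ ‼_)) (monomial r κ ≟ₗ α) (weight (toList κ))
      (proper⇔ G κ) (weight-coeff r κ κ<r α refl))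
  where
  r = length α
  coeff : ∀ {P Q R : Set} (P? : Dec P) (Q? : Dec Q) (R? : Dec R) f → P ⇔ Q → f α ≡ ind R? →
    ind (P? ×-dec R?) ≡ when Q? f α
  coeff (yes p) (yes q) R? f P⇔Q eq = sym eq
  coeff (yes p) (no ¬q) R? f P⇔Q eq = ⊥-elim (¬q (Equivalence.to P⇔Q p))
  coeff (no ¬p) (yes q) R? f P⇔Q eq = ⊥-elim (¬p (Equivalence.from P⇔Q q))
  coeff (no ¬p) (no ¬q) R? f P⇔Q eq = refl

-- Each coefficient α is checked with r = length α, whereas f, and with it the expansion, is the
-- same for all α.
VPositive⇒EPositive : ∀ G → VPositive G → EPositive G
VPositive⇒EPositive G (F , F-pos , F≈) with EPos-∑ F-pos
... | f , f-pos , ∑F≈f = EPos⇒EPositive G f-pos λ α → trans (X≡∑pointed G α) (trans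
  (RingSums.∑-cong (seriesRing (length α)) (length α) (F≈ (length α)) α refl)
  (∑F≈f (length α) α refl))

mainTheorem2 : (m : ℕ) .{{_ : NonZero m}} (a : Fin m → ℕ) (a≥2 : ∀ i → 2 ≤ a i) →
    EPositive (cycleChain m a a≥2)
mainTheorem2 m a a≥2 = VPositive⇒EPositive (cycleChain m a a≥2) (VPositive-chain m a a≥2)
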